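{- For every fixed $\epsilon>0$ and every sufficiently large $n$ the following holds. Let $G$ be a connected graph on $n$ vertices such that every vertex subset $U$ with $|U|\leq n/\log^4 n$ satisfies $|N_G(U)|\geq |U|\log^4 n/15$, and every vertex subset $W$ with $|W|\geq n/\log^3 n$ satisfies $|N_G(W)|\geq\frac{1+\epsilon}{2}n$. Then $G$ contains a Hamilton cycle.
   Context: $\log$ is the natural logarithm. For a vertex set $X$, $N_G(X)$ is the set of all vertices adjacent in $G$ to some vertex of $X$ (not necessarily disjoint from $X$). -}

module Defs where

open import Data.Bool using (Bool; true; false; _∧_)
open import Data.Nat as ℕ using (ℕ; zero; suc)
open import Data.Nat.DivMod using (_mod_)
open import Data.Fin using (Fin; toℕ)
open import Data.Fin.Subset using (Subset; ∣_∣)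
open import Data.Vec using (tabulate; lookup)
open import Data.List using (allFin)
open import Data.Bool.ListAction using (any)
open import Data.Integer using (+_)
open import Data.Rational using (ℚ; _/_; _+_; _*_; _<_; _≤_; 0ℚ; 1ℚ)
open import Data.Product using (Σ; ∃; _×_)
open import Data.Sum using (_⊎_)
open import Relation.Binary.PropositionalEquality using (_≡_)
open import Function.Definitions using (Injective)

record Graph (n : ℕ) : Set where
  field
    adj    : Fin n → Fin n → Bool
    sym    : ∀ u v → adj u v ≡ adj v u
    irrefl : ∀ v → adj v v ≡ false
open Graph public

nbhd : ∀ {n} → Graph n → Subset n → Subset n
nbhd {n} G U = tabulate (λ v → any (λ u → lookup U u ∧ adj G u v) (allFin n))

data Reach {n} (G : Graph n) : Fin n → Fin n → Set where
  here : ∀ {v} → Reach G v v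
  step : ∀ {u w v} → adj G u w ≡ true → Reach G w v → Reach G u v

Connected : ∀ {n} → Graph n → Set
Connected {n} G = (u v : Fin n) → Reach G u v

next : ∀ {n} → Fin n → Fin n
next {suc m} i = suc (toℕ i) mod suc m

-- Hamilton cycle: a cyclic ordering σ(0),…,σ(n-1) of all vertices
-- (σ injective, hence bijective) with consecutive vertices adjacent
HasHamiltonCycle : ∀ {n} → Graph n → Set
HasHamiltonCycle {n} G =
  Σ (Fin n → Fin n) λ σ → Injective _≡_ _≡_ σ × (∀ i → adj G (σ i) (σ (next i)) ≡ true)

ℕtoℚ : ℕ → ℚ
ℕtoℚ k = (+ k) / 1

powℚ : ℚ → ℕ → ℚ
powℚ t zero    = 1ℚ
powℚ t (suc k) = t * powℚ t k

expTerm : ℚ → ℕ → ℚ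
expTerm t zero    = 1ℚ
expTerm t (suc j) = expTerm t j * t * ((+ 1) / suc j)

expPartial : ℚ → ℕ → ℚ
expPartial t zero    = 0ℚ
expPartial t (suc N) = expPartial t N + expTerm t N

-- Comparisons with powers of the natural logarithm (no reals available).
-- For n ≥ 1, q ≥ 0 these are exact encodings, using that e^t is the
-- supremum of the increasing partial sums expPartial t N for t ≥ 0:
--
-- MulLogPowLe k n q p  ⟺  q · (log n)^k ≤ p
MulLogPowLe : ℕ → ℕ → ℚ → ℚ → Set
MulLogPowLe k n q p =
  ∀ (t : ℚ) → 0ℚ ≤ t → p < q * powℚ t k → ∃ λ N → ℕtoℚ n < expPartial t N

-- LeMulLogPow k n q p  ⟺  p ≤ q · (log n)^k
LeMulLogPow : ℕ → ℕ → ℚ → ℚ → Set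
LeMulLogPow k n q p =
  p ≤ 0ℚ ⊎ (0ℚ < q × (∀ (t : ℚ) → 0ℚ ≤ t → q * powℚ t k < p →
                          ∀ N → expPartial t N ≤ ℕtoℚ n))

{-# OPTIONS --safe #-}
-- Take a longest path.  All neighbours of an endpoint lie on it, so Pósa rotations apply at both ends.
-- Sets A and B of endpoints are grown in alternation, under the invariant that every pair
-- (a , b) ∈ A × B is joined by a path on the same vertices and that all these paths have the same
-- shape: a fixed signed arrangement of intervals of the original path, whose boundaries are constant,
-- or depend on a alone, or on b alone.  With K intervals, two pigeonhole arguments make the
-- next pivot lie in the same interval for all remaining pairs; this costs one side a factor O(K) and
-- the other O(K²), so that a round at both ends multiplies |A| and |B| by log⁴ n / O(K³).
-- As K may be a small multiple of log n, the gain exceeds a large multiple of log n, and O(log n)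
-- rounds take both sides from 1 to n / log³ n.  Every rotation breaks only one of the initial constant
-- intervals, so nearly all edges {y , x} of the original path are still traversed in one common direction;
-- since N(A) and N(B) both contain more than half of the vertices, some such edge, traversed from y to x,
-- has x ∈ N(A) and y ∈ N(B) and closes a cycle, which is Hamiltonian by connectivity and maximality.
module Submission where

-- The closing edge selects x and y, and these select a and b independently of each other, so its
-- direction of traversal must not depend on the pair; this is what forces a uniform shape.
-- Dependence of a cut on one endpoint alone survives a rotation because the new endpoint determines
-- its pivot, and `pick` fixes a single old endpoint for each pivot. That a pivot x lies in a given
-- interval then splits into a condition on x and its old endpoint, and a condition on x and b. The
-- second confines x to a range that varies with b. Ranges that hold many candidates and start in
-- the same block of ranks have a full block in common, so one piece and one set of pivots serve
-- many b at once. The hypotheses leave a gap: expansion by log⁴ n is known up to size n / log⁴ n,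
-- expansion beyond one half only from n / log³ n on. The last round has to bridge it, so the gain
-- of a round must be at least a large multiple of log n. There is a circularity: K grows with the
-- number of rounds, and the gain falls with K. It is broken because the gain tends to infinity, so
-- that log n / C rounds suffice for any constant C once n is large.

module Prelude where

  open import Data.Bool using (Bool; true; false; not) public
  open import Data.Nat public
  open import Data.Nat.Properties public
  open import Data.Nat.DivMod public
  open import Data.List hiding (lookup; tabulate; find; fromMaybe; or; and; any; all; sum; product) public
  open import Data.List.Properties hiding (sum-++) public
  open import Data.List.Membership.Propositional using (_∈_; _∉_) public
  open import Data.List.Membership.Propositional.Properties public
  open import Data.List.Relation.Unary.Any using (here; there) public
  open import Data.List.Relation.Unary.All using (All; []; _∷_) public
  open import Data.List.Relation.Unary.All.Properties using (All¬⇒¬Any) public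
  open import Data.List.Relation.Unary.AllPairs using ([]; _∷_) public
  open import Data.List.Relation.Unary.Unique.Propositional using (Unique) public
  open import Data.List.Relation.Binary.Permutation.Propositional using (_↭_; ↭-refl; ↭-sym; ↭-trans; ↭-reflexive) public
  open import Data.List.Relation.Binary.Permutation.Propositional.Properties using (↭-reverse; ++⁺ʳ; ++⁺ˡ; ++⁺; ↭-length; ∈-resp-↭; All-resp-↭) renaming (++-comm to ↭-++-comm) public
  open import Data.Product using (∃; _×_; _,_; proj₁; proj₂) public
  open import Data.Sum using (_⊎_; inj₁; inj₂) public
  open import Data.Empty using (⊥; ⊥-elim) public
  open import Relation.Nullary using (¬_; Dec; yes; no; ¬?; _×-dec_) public
  open import Relation.Binary.PropositionalEquality hiding ([_]) public
  open import Function using (_∘_; id) public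

-- Counting with duplicate-free lists; pigeonhole principles.

module Counting where

  open Prelude
  open import Data.List.Relation.Binary.Permutation.Setoid.Properties using (Unique-resp-↭)
  open import Data.List.Relation.Binary.Permutation.Propositional using (↭⇒↭ₛ)

  Unique-⊆⇒length≤ : {A : Set} {xs ys : List A} → Unique xs → (∀ {x} → x ∈ xs → x ∈ ys) → length xs ≤ length ys
  Unique-⊆⇒length≤ [] _ = z≤n
  Unique-⊆⇒length≤ {xs = x ∷ xs} (x∉ ∷ u) sub with ∈-∃++ (sub (here refl))
  ... | as , bs , refl = begin
      suc (length xs)             ≤⟨ s≤s (Unique-⊆⇒length≤ u sub′) ⟩
      suc (length (as ++ bs))     ≡⟨ cong suc (length-++ as) ⟩
      suc (length as + length bs) ≡⟨ +-suc (length as) (length bs) ⟨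
      length as + suc (length bs) ≡⟨ length-++ as ⟨
      length (as ++ x ∷ bs)       ∎
    where
    open ≤-Reasoning
    sub′ : ∀ {z} → z ∈ xs → z ∈ as ++ bs
    sub′ z∈ with ∈-++⁻ as (sub (there z∈))
    ... | inj₁ p         = ∈-++⁺ˡ p
    ... | inj₂ (there p) = ∈-++⁺ʳ as p
    ... | inj₂ (here refl) = ⊥-elim (All¬⇒¬Any x∉ z∈)

  module _ {A : Set} {P : A → Set} (P? : ∀ x → Dec (P x)) where

    length-filter-split : ∀ xs → length xs ≡ length (filter P? xs) + length (filter (¬? ∘ P?) xs)
    length-filter-split [] = refl
    length-filter-split (x ∷ xs) with P? x
    ... | yes _ = cong suc (length-filter-split xs)
    ... | no  _ = trans (cong suc (length-filter-split xs)) (sym (+-suc _ _))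

    module _ {Q : A → Set} (Q? : ∀ x → Dec (Q x)) where

      length-filter-filter : ∀ xs → length (filter Q? (filter P? xs)) ≤ length (filter Q? xs)
      length-filter-filter [] = z≤n
      length-filter-filter (x ∷ xs) with P? x
      ... | no  _ with Q? x
      ...   | yes _ = m≤n⇒m≤1+n (length-filter-filter xs)
      ...   | no  _ = length-filter-filter xs
      length-filter-filter (x ∷ xs) | yes _ with Q? x
      ...   | yes _ = s≤s (length-filter-filter xs)
      ...   | no  _ = length-filter-filter xs

  -- Induction on the colours: a colour held by at most N elements is discarded together with them,
  -- and enough elements remain for the other colours.
  pigeonhole : {A C : Set} {R : A → C → Set} (R? : ∀ a c → Dec (R a c)) (cs : List C) (xs : List A) (N : ℕ) →
    (∀ {x} → x ∈ xs → ∃ λ c → c ∈ cs × R x c) → length cs * N < length xs →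
    ∃ λ c → c ∈ cs × N < length (filter (λ x → R? x c) xs)
  pigeonhole R? [] (x ∷ xs) N cov _ with cov (here refl)
  ... | _ , () , _
  pigeonhole R? (c ∷ cs) xs N cov big with N <? length (filter (λ x → R? x c) xs)
  ... | yes p = c , here refl , p
  ... | no ¬p = c′ , there c′∈ , <-≤-trans N< (length-filter-filter _ _ xs)
    where
    rest = filter (¬? ∘ λ x → R? x c) xs
    cov′ : ∀ {x} → x ∈ rest → ∃ λ d → d ∈ cs × _
    cov′ x∈ with ∈-filter⁻ (¬? ∘ λ x → R? x c) {xs = xs} x∈
    ... | x∈xs , ¬r with cov x∈xs
    ...   | _ , here refl , r = ⊥-elim (¬r r)
    ...   | d , there d∈ , r = d , d∈ , r
    big′ : length cs * N < length rest
    big′ = +-cancelˡ-< N _ _ (<-≤-trans big (≤-trans (≤-reflexive (length-filter-split (λ x → R? x c) xs))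
             (+-monoˡ-≤ (length rest) (≮⇒≥ ¬p))))
    ih = pigeonhole R? cs rest N cov′ big′
    c′ = proj₁ ih
    c′∈ = proj₁ (proj₂ ih)
    N< = proj₂ (proj₂ ih)

  popular : {A C : Set} {R : A → C → Set} (R? : ∀ a c → Dec (R a c)) (cs : List C) (xs : List A) →
    0 < length xs → (∀ {x} → x ∈ xs → ∃ λ c → c ∈ cs × R x c) →
    ∃ λ c → c ∈ cs × length xs ≤ length cs * length (filter (λ x → R? x c) xs)
  popular R? [] (x ∷ xs) _ cov with cov (here refl)
  ... | _ , () , _
  popular R? cs@(_ ∷ _) xs@(_ ∷ ys) _ cov = c , c∈ , (begin
      suc (length ys)                                      ≡⟨ cong suc (m≡m%n+[m/n]*n (length ys) k) ⟩
      suc (length ys % k) + N * k                          ≤⟨ +-monoˡ-≤ (N * k) (m%n<n (length ys) k) ⟩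
      suc N * k                                            ≡⟨ *-comm (suc N) k ⟩
      k * suc N                                            ≤⟨ *-monoʳ-≤ k N< ⟩
      k * length (filter (λ x → R? x c) xs)                ∎)
    where
    open ≤-Reasoning
    k = length cs
    -- The largest N with `k * N < length xs`; the strict inequality of `pigeonhole` then yields the
    -- quotient rounded up.
    N = length ys / k
    found = pigeonhole R? cs xs N cov
      (s≤s (≤-trans (≤-reflexive (*-comm k N)) (m/n*n≤m (length ys) k)))
    c = proj₁ found
    c∈ = proj₁ (proj₂ found)
    N< = proj₂ (proj₂ found)

  Unique-↭ : {A : Set} {xs ys : List A} → xs ↭ ys → Unique xs → Unique ys
  Unique-↭ {A} p = Unique-resp-↭ (setoid A) (↭⇒↭ₛ p)

-- Walks, and paths given by signed intervals with symbolic boundaries.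

module SymbolicPaths where

  open Prelude
  open Counting

  module Walks {A : Set} (E : A → A → Set) where

    data Walk : A → List A → A → Set where
      nil  : ∀ {a} → Walk a (a ∷ []) a
      cons : ∀ {a c xs b} → E a c → Walk c xs b → Walk a (a ∷ xs) b

    walk-++ : ∀ {a b c d xs ys} → Walk a xs b → E b c → Walk c ys d → Walk a (xs ++ ys) d
    walk-++ nil        e w = cons e w
    walk-++ (cons f v) e w = cons f (walk-++ v e w)

    walk-split : ∀ {a b} xs {y x ys} → Walk a (xs ++ y ∷ x ∷ ys) b →
      Walk a (xs ++ y ∷ []) y × E y x × Walk x (x ∷ ys) b
    walk-split []            (cons e w@nil)        = nil , e , w
    walk-split []            (cons e w@(cons _ _)) = nil , e , w
    walk-split (_ ∷ [])      (cons e w) with walk-split [] w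
    walk-split (_ ∷ []) (cons e (cons _ _)) | v , f , w′ = cons e v , f , w′
    walk-split (_ ∷ xs@(_ ∷ _)) (cons e w) with walk-split xs w
    ... | v , f , w′ = cons e v , f , w′

    walk-reverse : (∀ {x y} → E x y → E y x) → ∀ {a b xs} → Walk a xs b → Walk b (reverse xs) a
    walk-reverse E-sym nil = nil
    walk-reverse E-sym {a} {b} (cons {xs = xs} e w) =
      subst (λ zs → Walk b zs a) (sym (unfold-reverse a xs)) (walk-++ (walk-reverse E-sym w) (E-sym e) nil)

    walk-head : ∀ {a b x xs} → Walk a (x ∷ xs) b → a ≡ x
    walk-head nil        = refl
    walk-head (cons _ _) = refl

    -- The Pósa rotation: the edge from a to the pivot x replaces the edge from y to x, and the part
    -- up to y is traversed backwards.
    rotate-walk : (∀ {x y} → E x y → E y x) → ∀ {a b} xs {y x ys} →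
      Walk a (xs ++ y ∷ x ∷ ys) b → E a x → Walk y (reverse (xs ++ y ∷ []) ++ x ∷ ys) b
    rotate-walk E-sym xs w e with walk-split xs w
    ... | v , _ , w′ = walk-++ (walk-reverse E-sym v) e w′

  from : ℕ → ℕ → List ℕ
  from l zero    = []
  from l (suc k) = l ∷ from (suc l) k

  length-from : ∀ l k → length (from l k) ≡ k
  length-from l zero    = refl
  length-from l (suc k) = cong suc (length-from (suc l) k)

  from-++ : ∀ l j k → from l (j + k) ≡ from l j ++ from (l + j) k
  from-++ l zero    k = cong (λ z → from z k) (sym (+-identityʳ l))
  from-++ l (suc j) k = cong (l ∷_) (trans (from-++ (suc l) j k) (cong (λ z → from (suc l) j ++ from z k) (sym (+-suc l j))))

  ∈-from⁻ : ∀ {x} l k → x ∈ from l k → l ≤ x × x < l + k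
  ∈-from⁻ l (suc k) (here refl) = ≤-refl , m<m+n l z<s
  ∈-from⁻ {x} l (suc k) (there p) with ∈-from⁻ (suc l) k p
  ... | l<x , x< = <⇒≤ l<x , subst (x <_) (sym (+-suc l k)) x<

  from≡upTo : ∀ m → from 0 m ≡ upTo m
  from≡upTo m = go 0 m id (λ _ → refl)
    where
    go : ∀ l k f → (∀ i → f i ≡ l + i) → from l k ≡ applyUpTo f k
    go l zero    f eq = refl
    go l (suc k) f eq = cong₂ _∷_ (sym (trans (eq 0) (+-identityʳ l)))
                          (go (suc l) k (f ∘ suc) (λ i → trans (eq (suc i)) (+-suc l i)))

  -- A cut position of the path from a to b: constant, a function of a alone, or of b alone.
  data Cut : Set where
    const : ℕ → Cut
    left  : (ℕ → ℕ) → Cut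
    right : (ℕ → ℕ) → Cut

  ⟦_⟧ : Cut → ℕ → ℕ → ℕ
  ⟦ const c ⟧ a b = c
  ⟦ left f ⟧  a b = f a
  ⟦ right f ⟧ a b = f b

  -- The positions in [lo , hi), ascending or descending.
  record Piece : Set where
    constructor piece
    field
      asc   : Bool
      lo hi : Cut
  open Piece public

  interval : Bool → ℕ → ℕ → List ℕ
  interval true  l u = from l (u ∸ l)
  interval false l u = reverse (from l (u ∸ l))

  seg : Piece → ℕ → ℕ → List ℕ
  seg (piece s l u) a b = interval s (⟦ l ⟧ a b) (⟦ u ⟧ a b)

  path : List Piece → ℕ → ℕ → List ℕ
  path []      a b = []
  path (p ∷ S) a b = seg p a b ++ path S a b

  path-++ : ∀ Q R a b → path (Q ++ R) a b ≡ path Q a b ++ path R a b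
  path-++ []      R a b = refl
  path-++ (p ∷ Q) R a b = trans (cong (seg p a b ++_) (path-++ Q R a b)) (sym (++-assoc (seg p a b) _ _))

  flip : Piece → Piece
  flip (piece s l u) = piece (not s) l u

  rev : List Piece → List Piece
  rev S = reverse (map flip S)

  seg-flip : ∀ p a b → seg (flip p) a b ≡ reverse (seg p a b)
  seg-flip (piece true  l u) a b = refl
  seg-flip (piece false l u) a b = sym (reverse-involutive _)

  path-rev : ∀ S a b → path (rev S) a b ≡ reverse (path S a b)
  path-rev []      a b = refl
  path-rev (p ∷ S) a b = begin
    path (reverse (flip p ∷ map flip S)) a b            ≡⟨ cong (λ z → path z a b) (unfold-reverse (flip p) (map flip S)) ⟩
    path (rev S ++ flip p ∷ []) a b                     ≡⟨ path-++ (rev S) _ a b ⟩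
    path (rev S) a b ++ (seg (flip p) a b ++ [])        ≡⟨ cong₂ _++_ (path-rev S a b) (trans (++-identityʳ _) (seg-flip p a b)) ⟩
    reverse (path S a b) ++ reverse (seg p a b)         ≡⟨ reverse-++ (seg p a b) (path S a b) ⟨
    reverse (seg p a b ++ path S a b)                   ∎
    where open ≡-Reasoning

  ∈-seg⁻ : ∀ {x} p a b → x ∈ seg p a b → ⟦ lo p ⟧ a b ≤ x × x < ⟦ hi p ⟧ a b
  ∈-seg⁻ (piece true l u) a b x∈ = bounds x∈
    where
    bounds : ∀ {x} → x ∈ from (⟦ l ⟧ a b) (⟦ u ⟧ a b ∸ ⟦ l ⟧ a b) → ⟦ l ⟧ a b ≤ x × x < ⟦ u ⟧ a b
    bounds {x} x∈ with ≤-total (⟦ l ⟧ a b) (⟦ u ⟧ a b)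
    ... | inj₁ l≤u = let p , q = ∈-from⁻ _ _ x∈ in p , subst (x <_) (m+[n∸m]≡n l≤u) q
    ... | inj₂ u≤l with subst (λ k → x ∈ from (⟦ l ⟧ a b) k) (m≤n⇒m∸n≡0 u≤l) x∈
    ... | ()
  ∈-seg⁻ (piece false l u) a b x∈ = ∈-seg⁻ (piece true l u) a b (∈-resp-↭ (↭-reverse _) x∈)

  path-∈⁻ : ∀ {x} S a b → x ∈ path S a b → ∃ λ p → p ∈ S × x ∈ seg p a b
  path-∈⁻ (p ∷ S) a b x∈ with ∈-++⁻ (seg p a b) x∈
  ... | inj₁ q = p , here refl , q
  ... | inj₂ q with path-∈⁻ S a b q
  ... | p′ , p∈ , q′ = p′ , there p∈ , q′

-- Rotations carried out on the symbolic description.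

module SymbolicRotations where

  open Prelude
  open Counting
  open SymbolicPaths

  from-cut : ∀ {l u y} → l ≤ y → suc y < u → ∃ λ zs → ∃ λ ws →
    from l (u ∸ l) ≡ zs ++ y ∷ suc y ∷ ws × from l (suc y ∸ l) ≡ zs ++ y ∷ [] × from (suc y) (u ∸ suc y) ≡ suc y ∷ ws
  from-cut {l} {u} {y} l≤y y<u with m≤n⇒∃[o]m+o≡n l≤y | m≤n⇒∃[o]m+o≡n y<u
  ... | d , refl | e , refl = from l d , from (suc (suc y)) e , eq₁ , eq₂ , cong (from (suc y)) (trans (cong (_∸ y) (sym (+-suc y e))) (m+n∸m≡n y (suc e)))
    where
    eq₁ : from l (suc (suc (l + d)) + e ∸ l) ≡ from l d ++ (l + d) ∷ suc (l + d) ∷ from (suc (suc (l + d))) e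
    eq₁ = trans (cong (from l) (trans (cong (_∸ l) (begin
        suc (suc (l + d)) + e   ≡⟨ cong suc (+-suc (l + d) e) ⟨
        suc ((l + d) + suc e)   ≡⟨ +-suc (l + d) (suc e) ⟨
        (l + d) + suc (suc e)   ≡⟨ +-assoc l d (suc (suc e)) ⟩
        l + (d + suc (suc e))   ∎)) (m+n∸m≡n l (d + suc (suc e))))) (from-++ l d (suc (suc e)))
      where open ≡-Reasoning
    eq₂ : from l (suc (l + d) ∸ l) ≡ from l d ++ (l + d) ∷ []
    eq₂ = trans (cong (from l) (trans (cong (_∸ l) (trans (cong suc (+-comm l d)) (+-comm (suc d) l))) (trans (m+n∸m≡n l (suc d)) (+-comm 1 d)))) (from-++ l d 1)

  -- `h` leads from a new left endpoint to the old one from which it arose, so that old data become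
  -- functions of the new endpoint. Data of b are not touched.
  reindex : (ℕ → ℕ) → Cut → Cut
  reindex h (const c) = const c
  reindex h (left f)  = left (f ∘ h)
  reindex h (right f) = right f

  reindexPiece : (ℕ → ℕ) → Piece → Piece
  reindexPiece h (piece s l u) = piece s (reindex h l) (reindex h u)

  ⟦reindex⟧ : ∀ h c a b → ⟦ reindex h c ⟧ a b ≡ ⟦ c ⟧ (h a) b
  ⟦reindex⟧ h (const c) a b = refl
  ⟦reindex⟧ h (left f)  a b = refl
  ⟦reindex⟧ h (right f) a b = refl

  path-reindex : ∀ h S a b → path (map (reindexPiece h) S) a b ≡ path S (h a) b
  path-reindex h []                  a b = refl
  path-reindex h (piece s l u ∷ S) a b =
    cong₂ _++_ (cong₂ (interval s) (⟦reindex⟧ h l a b) (⟦reindex⟧ h u a b)) (path-reindex h S a b)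

  -- Rotating at the edge {y , y+1} of a piece: the walk from a is entered at pivot, and endpoint becomes its first vertex.
  endpoint pivot : Bool → ℕ → ℕ
  endpoint true  y = y
  endpoint false y = suc y
  pivot    true  y = suc y
  pivot    false y = y

  -- Between y and y + 1 the half-open convention cuts at y + 1. This is the successor of the new
  -- endpoint in an ascending piece, and the new endpoint itself in a descending one.
  newCut : Bool → Cut
  newCut true  = left suc
  newCut false = left id

  -- The order meant is that of traversal: in a descending piece `before` receives the larger
  -- positions.
  before after : Piece → Cut → Piece
  before (piece true  l u) c = piece true  l c
  before (piece false l u) c = piece false c u
  after  (piece true  l u) c = piece true  c u
  after  (piece false l u) c = piece false l c

  -- The initial part Q, `before` is turned round as a whole, so its pieces change both order and
  -- sign; `after` and R stay as they are.
  rotated : (ℕ → ℕ) → List Piece → Piece → List Piece → List Piece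
  rotated h Q p R = flip (before p′ c) ∷ rev (map (reindexPiece h) Q) ++ after p′ c ∷ map (reindexPiece h) R
    where
    p′ = reindexPiece h p
    c = newCut (asc p)

  module Rotations (m : ℕ) (E : ℕ → ℕ → Set) (E-sym : ∀ {x y} → E x y → E y x) where

    open Walks E

    Spans : ℕ → ℕ → List ℕ → Set
    Spans a b xs = Walk a xs b × xs ↭ upTo m

    rotate-spans : ∀ {a b} xs zs {y x} ws ys → Spans a b (xs ++ (zs ++ y ∷ x ∷ ws) ++ ys) → E a x →
      Spans y b (reverse (zs ++ y ∷ []) ++ reverse xs ++ (x ∷ ws) ++ ys)
    rotate-spans {a} {b} xs zs {y} {x} ws ys (w , perm) e =
      subst (Spans y b) shape
        (rotate-walk E-sym (xs ++ zs) (subst (λ z → Walk a z b) regroup w) e ,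
         ↭-trans (++⁺ʳ (x ∷ ws ++ ys) (↭-reverse ((xs ++ zs) ++ y ∷ [])))
           (↭-trans (↭-reflexive (trans (++-assoc (xs ++ zs) (y ∷ []) _) (sym regroup))) perm))
      where
      open ≡-Reasoning
      regroup : xs ++ (zs ++ y ∷ x ∷ ws) ++ ys ≡ (xs ++ zs) ++ y ∷ x ∷ ws ++ ys
      regroup = trans (cong (xs ++_) (++-assoc zs (y ∷ x ∷ ws) ys)) (sym (++-assoc xs zs _))
      shape : reverse ((xs ++ zs) ++ y ∷ []) ++ x ∷ ws ++ ys ≡ reverse (zs ++ y ∷ []) ++ reverse xs ++ (x ∷ ws) ++ ys
      shape = begin
        reverse ((xs ++ zs) ++ y ∷ []) ++ x ∷ ws ++ ys       ≡⟨ cong (λ z → reverse z ++ x ∷ ws ++ ys) (++-assoc xs zs (y ∷ [])) ⟩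
        reverse (xs ++ zs ++ y ∷ []) ++ x ∷ ws ++ ys         ≡⟨ cong (_++ x ∷ ws ++ ys) (reverse-++ xs (zs ++ y ∷ [])) ⟩
        (reverse (zs ++ y ∷ []) ++ reverse xs) ++ x ∷ ws ++ ys ≡⟨ ++-assoc (reverse (zs ++ y ∷ [])) (reverse xs) _ ⟩
        reverse (zs ++ y ∷ []) ++ reverse xs ++ (x ∷ ws) ++ ys ∎

    piece-cut : ∀ p h a b y → ⟦ lo p ⟧ (h a) b ≤ y → suc y < ⟦ hi p ⟧ (h a) b → a ≡ endpoint (asc p) y →
      ∃ λ zs → ∃ λ ws →
        seg p (h a) b ≡ zs ++ endpoint (asc p) y ∷ pivot (asc p) y ∷ ws ×
        seg (before (reindexPiece h p) (newCut (asc p))) a b ≡ zs ++ endpoint (asc p) y ∷ [] ×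
        seg (after (reindexPiece h p) (newCut (asc p))) a b ≡ pivot (asc p) y ∷ ws
    piece-cut (piece true l u) h a b y l≤ <u refl
      rewrite ⟦reindex⟧ h l a b | ⟦reindex⟧ h u a b = from-cut l≤ <u
    piece-cut (piece false l u) h a b y l≤ <u refl
      rewrite ⟦reindex⟧ h l a b | ⟦reindex⟧ h u a b with from-cut l≤ <u
    ... | zs , ws , eq , eq₁ , eq₂ =
      reverse ws , reverse zs ,
      trans (cong reverse eq) (trans (reverse-++ zs (y ∷ suc y ∷ ws))
        (trans (cong (_++ reverse zs) (trans (unfold-reverse y (suc y ∷ ws)) (cong (_∷ʳ y) (unfold-reverse (suc y) ws))))
          (trans (++-assoc (reverse ws ∷ʳ suc y) (y ∷ []) (reverse zs)) (++-assoc (reverse ws) (suc y ∷ []) _)))) ,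
      trans (cong reverse eq₂) (unfold-reverse (suc y) ws) ,
      trans (cong reverse eq₁) (reverse-++ zs (y ∷ []))

    rotated-spans : ∀ Q p R h {a a′ b} y → h a′ ≡ a → a′ ≡ endpoint (asc p) y →
      ⟦ lo p ⟧ a b ≤ y → suc y < ⟦ hi p ⟧ a b → E a (pivot (asc p) y) →
      Spans a b (path (Q ++ p ∷ R) a b) → Spans a′ b (path (rotated h Q p R) a′ b)
    rotated-spans Q p R h {a′ = a} {b} y refl refl l≤ <u e sp with piece-cut p h a b y l≤ <u refl
    ... | zs , ws , eq , eq₁ , eq₂ = subst (Spans a b) (sym shape)
        (rotate-spans (path Q (h a) b) zs ws (path R (h a) b)
          (subst (Spans (h a) b) (trans (path-++ Q (p ∷ R) (h a) b) (cong (λ z → path Q (h a) b ++ z ++ path R (h a) b) eq)) sp) e)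
      where
      shape : path (rotated h Q p R) a b ≡ reverse (zs ++ a ∷ []) ++ reverse (path Q (h a) b) ++ (pivot (asc p) y ∷ ws) ++ path R (h a) b
      shape = cong₂ _++_ (trans (seg-flip (before (reindexPiece h p) (newCut (asc p))) a b) (cong reverse eq₁))
        (trans (path-++ (rev (map (reindexPiece h) Q)) _ a b)
          (cong₂ _++_ (trans (path-rev (map (reindexPiece h) Q) a b) (cong reverse (path-reindex h Q a b)))
            (cong₂ _++_ eq₂ (path-reindex h R a b))))

-- Pivots that lie in one common piece for all remaining pairs.

module PivotSelection where

  open Prelude
  open Counting
  open SymbolicPaths
  open SymbolicRotations
  open import Data.List.Membership.Propositional using (lose)
  open import Data.List.Membership.DecPropositional _≟_ using (_∈?_; _∉?_)
  open import Data.List.Relation.Unary.Unique.Propositional.Properties using () renaming (filter⁺ to Unique-filter)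
  open import Data.List.Relation.Unary.All as All using (all?)

  extremum : {A : Set} {_≼_ : ℕ → ℕ → Set} → (∀ x y → x ≼ y ⊎ y ≼ x) → (∀ {x y z} → x ≼ y → y ≼ z → x ≼ z) →
    (f : A → ℕ) (xs : List A) → 0 < length xs → ∃ λ x → x ∈ xs × (∀ {y} → y ∈ xs → f y ≼ f x)
  extremum total ≼-trans f (x ∷ []) _ = x , here refl , λ { (here refl) → reduce (total (f x) (f x)) }
    where open import Data.Sum using (reduce)
  extremum total ≼-trans f (x ∷ xs@(_ ∷ _)) _ with extremum total ≼-trans f xs z<s
  ... | z , z∈ , max with total (f x) (f z)
  ...   | inj₁ x≼z = z , there z∈ , λ { (here refl) → x≼z ; (there y∈) → max y∈ }
  ...   | inj₂ z≼x = x , here refl , λ { (here refl) → reduce (total (f x) (f x)) ; (there y∈) → ≼-trans (max y∈) z≼x }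
    where open import Data.Sum using (reduce)

  nonempty-∈ : {A : Set} {xs : List A} → 0 < length xs → ∃ (_∈ xs)
  nonempty-∈ {xs = x ∷ _} _ = x , here refl

  -- In a piece with sign s and boundary values u and v, the pivots x that are not the first vertex of the piece are low s u ≤ x < high s v.
  low high : Bool → ℕ → ℕ
  low  true  u = suc u
  low  false u = u
  high true  v = v
  high false v = v ∸ 1

  Inside : Piece → ℕ → ℕ → ℕ → Set
  Inside p a b x = low (asc p) (⟦ lo p ⟧ a b) ≤ x × x < high (asc p) (⟦ hi p ⟧ a b)

  -- The predecessor of the vertex at which a piece is entered lies outside the piece, so a rotation
  -- there would not cut the piece in two. Such pivots are set aside.
  entry : Piece → ℕ → ℕ → ℕ
  entry (piece true  l u) a b = ⟦ l ⟧ a b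
  entry (piece false l u) a b = ⟦ u ⟧ a b ∸ 1

  notEntry⇒Inside : ∀ {x} p a b → x ∈ seg p a b → x ≢ entry p a b → Inside p a b x
  notEntry⇒Inside p@(piece true l u) a b x∈ x≢ with ∈-seg⁻ p a b x∈
  ... | l≤x , x<u = ≤∧≢⇒< l≤x (x≢ ∘ sym) , x<u
  notEntry⇒Inside p@(piece false l u) a b x∈ x≢ with ∈-seg⁻ p a b x∈
  ... | l≤x , x<u = l≤x , ≤∧≢⇒< (≤-pred (≤-trans x<u (m≤n+m∸n _ 1))) x≢

  ⟦⟧-factors : ∀ c a b → ⟦ c ⟧ a b ≡ ⟦ c ⟧ a 0 ⊎ ⟦ c ⟧ a b ≡ ⟦ c ⟧ 0 b
  ⟦⟧-factors (const c) a b = inj₁ refl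
  ⟦⟧-factors (left f)  a b = inj₁ refl
  ⟦⟧-factors (right f) a b = inj₂ refl

  entry-factors : ∀ p a b → entry p a b ≡ entry p a 0 ⊎ entry p a b ≡ entry p 0 b
  entry-factors (piece true  l u) a b = ⟦⟧-factors l a b
  entry-factors (piece false l u) a b with ⟦⟧-factors u a b
  ... | inj₁ eq = inj₁ (cong (_∸ 1) eq)
  ... | inj₂ eq = inj₂ (cong (_∸ 1) eq)

  entries : List Piece → ℕ → ℕ → List ℕ
  entries S a b = map (λ p → entry p a b) S

  length-concatMap-const : {A B : Set} (f : A → List B) (k : ℕ) → (∀ x → length (f x) ≡ k) → ∀ xs → length (concatMap f xs) ≡ length xs * k
  length-concatMap-const f k eq []       = refl
  length-concatMap-const f k eq (x ∷ xs) = trans (length-++ (f x)) (cong₂ _+_ (eq x) (length-concatMap-const f k eq xs))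

  length-cartesianProduct : {A B : Set} (xs : List A) (ys : List B) → length (cartesianProduct xs ys) ≡ length xs * length ys
  length-cartesianProduct []       ys = refl
  length-cartesianProduct (x ∷ xs) ys = trans (length-++ (map (x ,_) ys)) (cong₂ _+_ (length-map _ ys) (length-cartesianProduct xs ys))

  module Selection (m : ℕ) where

    -- The share of `Inside` that concerns a; a bound depending on b is replaced by the trivial
    -- bound 0 or m. Constant bounds belong to this share, so only bounds that really vary with b
    -- are left for the other.
    lowˡ highˡ : Bool → Cut → ℕ → ℕ
    lowˡ s (right f) a = 0
    lowˡ s (left f)  a = low s (f a)
    lowˡ s (const c) a = low s c
    highˡ s (right f) a = m
    highˡ s (left f)  a = high s (f a)
    highˡ s (const c) a = high s c

    lowʳ highʳ : Bool → Cut → ℕ → ℕ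
    lowʳ s (right f) b = low s (f b)
    lowʳ s (left f)  b = 0
    lowʳ s (const c) b = 0
    highʳ s (right f) b = high s (f b)
    highʳ s (left f)  b = m
    highʳ s (const c) b = m

    Insideˡ Insideʳ : Piece → ℕ → ℕ → Set
    Insideˡ p a x = lowˡ (asc p) (lo p) a ≤ x × x < highˡ (asc p) (hi p) a
    Insideʳ p b x = lowʳ (asc p) (lo p) b ≤ x × x < highʳ (asc p) (hi p) b

    low-split : ∀ s c a b {x} → low s (⟦ c ⟧ a b) ≤ x → lowˡ s c a ≤ x × lowʳ s c b ≤ x
    low-split s (const c) a b p = p , z≤n
    low-split s (left f)  a b p = p , z≤n
    low-split s (right f) a b p = z≤n , p

    high-split : ∀ s c a b {x} → x < m → x < high s (⟦ c ⟧ a b) → x < highˡ s c a × x < highʳ s c b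
    high-split s (const c) a b x<m p = p , x<m
    high-split s (left f)  a b x<m p = p , x<m
    high-split s (right f) a b x<m p = x<m , p

    Inside-split : ∀ p a b {x} → x < m → Inside p a b x → Insideˡ p a x × Insideʳ p b x
    Inside-split (piece s l u) a b x<m (p , q) =
      let p₁ , p₂ = low-split s l a b p ; q₁ , q₂ = high-split s u a b x<m q in (p₁ , q₁) , (p₂ , q₂)

    Inside-join : ∀ p a b {x} → Insideˡ p a x → Insideʳ p b x → Inside p a b x
    Inside-join (piece s l u) a b (p₁ , q₁) (p₂ , q₂) = joinLow l p₁ p₂ , joinHigh u q₁ q₂
      where
      joinLow : ∀ c {x} → lowˡ s c a ≤ x → lowʳ s c b ≤ x → low s (⟦ c ⟧ a b) ≤ x
      joinLow (const c) p _ = p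
      joinLow (left f)  p _ = p
      joinLow (right f) _ p = p
      joinHigh : ∀ c {x} → x < highˡ s c a → x < highʳ s c b → x < high s (⟦ c ⟧ a b)
      joinHigh (const c) p _ = p
      joinHigh (left f)  p _ = p
      joinHigh (right f) _ p = p

    -- Here w is the number of pivots to be retained. In the lower bound on X, the first summand
    -- pays for the excluded entries and the second leaves more than 2w pivots in some piece; the
    -- upper bound limits the number of blocks of w ranks to 8K.
    module _ (S : List Piece) (A B X : List ℕ) (pick : ℕ → ℕ) (K w : ℕ)
      (X! : Unique X) (B≢[] : 0 < length B)
      (pick∈ : ∀ {x} → x ∈ X → pick x ∈ A) (X<m : ∀ {x} → x ∈ X → x < m)
      (on-path : ∀ {x b} → x ∈ X → b ∈ B → x ∈ path S (pick x) b)
      (S≤K : length S ≤ K) (X-large : suc (length A) * K + K * (2 * w) < length X) (X-small : length X < 8 * K * w)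
      where

      insideˡ? : ∀ p x → Dec (Insideˡ p (pick x) x)
      insideˡ? p x = _ ≤? _ ×-dec _ <? _

      insideʳ? : ∀ p b x → Dec (Insideʳ p b x)
      insideʳ? p b x = _ ≤? _ ×-dec _ <? _

      inside? : ∀ b x p → Dec (Inside p (pick x) b x)
      inside? b x p = _ ≤? _ ×-dec _ <? _

      cands : Piece → List ℕ
      cands p = filter (insideˡ? p) X

      cands! : ∀ p → Unique (cands p)
      cands! p = Unique-filter (insideˡ? p) X!

      -- The rank of z among the candidates. Candidates may be spread unevenly over the positions,
      -- so ranges are compared by ranks.
      below : Piece → ℕ → ℕ
      below p z = length (filter (_<? z) (cands p))

      -- For b of this colour, the range of admissible ranks starts in block j of width w and has
      -- length at least 2w. Hence the ranges of all such b contain block j + 1 entirely.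
      Colour : ℕ → Piece × ℕ → Set
      Colour b (p , j) = below p (lowʳ (asc p) (lo p) b) + 2 * w ≤ below p (highʳ (asc p) (hi p) b)
        × j * w ≤ below p (lowʳ (asc p) (lo p) b) × below p (lowʳ (asc p) (lo p) b) < suc j * w

      colour? : ∀ b c → Dec (Colour b c)
      colour? b (p , j) = _ ≤? _ ×-dec _ ≤? _ ×-dec _ <? _

      -- At most K pieces times 8K blocks: the origin of the factor 8K² lost by B.
      colours : List (Piece × ℕ)
      colours = cartesianProduct S (upTo (8 * K))

      -- An entry is a single cut up to a shift and thus depends on at most one endpoint; 0 fills
      -- the argument that has no influence.
      blocked : ℕ → List ℕ
      blocked b = concatMap (λ a → entries S a 0) A ++ entries S 0 b

      0<w : 0 < w
      0<w = n≢0⇒n>0 λ { refl → n≮0 (subst (length X <_) (*-zeroʳ (8 * K)) X-small) }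

      free : ℕ → List ℕ
      free b = filter (_∉? blocked b) X

      free∈⁻ : ∀ {b x} → x ∈ free b → x ∈ X × x ∉ blocked b
      free∈⁻ {b} = ∈-filter⁻ (_∉? blocked b) {xs = X}

      covered : ∀ {b x} → b ∈ B → x ∈ free b → ∃ λ p → p ∈ S × Inside p (pick x) b x
      covered {b} {x} b∈ x∈ with path-∈⁻ S (pick x) b (on-path (proj₁ (free∈⁻ {b} x∈)) b∈)
      ... | p , p∈ , x∈p = p , p∈ , notEntry⇒Inside p (pick x) b x∈p not-entry
        where
        x∈X = proj₁ (free∈⁻ {b} x∈)
        x∉ = proj₂ (free∈⁻ {b} x∈)
        not-entry : x ≢ entry p (pick x) b
        not-entry x≡ with entry-factors p (pick x) b
        ... | inj₁ eq = x∉ (∈-++⁺ˡ (∈-concatMap⁺ (λ a → entries S a 0) (lose (pick∈ x∈X) (subst (_∈ entries S (pick x) 0) (sym (trans x≡ eq)) (∈-map⁺ _ p∈)))))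
        ... | inj₂ eq = x∉ (∈-++⁺ʳ _ (subst (_∈ entries S 0 b) (sym (trans x≡ eq)) (∈-map⁺ _ p∈)))

      blocked-length : ∀ b → length (blocked b) ≤ suc (length A) * K
      blocked-length b = begin
        length (blocked b)                  ≡⟨ length-++ (concatMap (λ a → entries S a 0) A) ⟩
        length (concatMap (λ a → entries S a 0) A) + length (entries S 0 b)
          ≡⟨ cong₂ _+_ (length-concatMap-const (λ a → entries S a 0) (length S) (λ a → length-map _ S) A) (length-map _ S) ⟩
        length A * length S + length S      ≡⟨ +-comm _ (length S) ⟩
        suc (length A) * length S           ≤⟨ *-monoʳ-≤ (suc (length A)) S≤K ⟩
        suc (length A) * K                  ∎
        where open ≤-Reasoning

      free-large : ∀ b → length S * (2 * w) < length (free b)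
      free-large b = +-cancelˡ-< (suc (length A) * K) _ _ (≤-<-trans (+-monoʳ-≤ (suc (length A) * K) (*-monoˡ-≤ (2 * w) S≤K))
        (<-≤-trans X-large (≤-trans X≤ (+-monoˡ-≤ (length (free b)) (blocked-length b)))))
        where
        split : ∀ {x} → x ∈ X → x ∈ blocked b ++ free b
        split {x} x∈ with x ∈? blocked b
        ... | yes p = ∈-++⁺ˡ p
        ... | no ¬p = ∈-++⁺ʳ (blocked b) (∈-filter⁺ (_∉? blocked b) x∈ ¬p)
        X≤ : length X ≤ length (blocked b) + length (free b)
        X≤ = ≤-trans (Unique-⊆⇒length≤ X! split) (≤-reflexive (length-++ (blocked b)))

      -- The pivots inside p for this b are candidates between the two right bounds, hence counted
      -- by a difference of ranks.
      gap : ∀ b p → 2 * w < length (filter (λ x → inside? b x p) (free b)) →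
        below p (lowʳ (asc p) (lo p) b) + 2 * w ≤ below p (highʳ (asc p) (hi p) b)
      gap b p many = begin
        below p l + 2 * w             ≤⟨ +-mono-≤ below-l (≤-trans (<⇒≤ many) good≤) ⟩
        length (filter (_<? l) ys) + length (filter (¬? ∘ (_<? l)) ys) ≡⟨ length-filter-split (_<? l) ys ⟨
        below p u                     ∎
        where
        open ≤-Reasoning
        l = lowʳ (asc p) (lo p) b
        u = highʳ (asc p) (hi p) b
        ys = filter (_<? u) (cands p)
        good = filter (λ x → inside? b x p) (free b)
        good∈⁻ : ∀ {x} → x ∈ good → x ∈ cands p × Insideʳ p b x
        good∈⁻ {x} x∈ =
          let x∈free , ins = ∈-filter⁻ (λ x → inside? b x p) {v = x} {xs = free b} x∈
              x∈X , _ = free∈⁻ {b} {x} x∈free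
              insˡ , insʳ = Inside-split p (pick x) b (X<m x∈X) ins
          in ∈-filter⁺ (insideˡ? p) {xs = X} x∈X insˡ , insʳ
        good≤ : length good ≤ length (filter (¬? ∘ (_<? l)) ys)
        good≤ = Unique-⊆⇒length≤ (Unique-filter (λ x → inside? b x p) (Unique-filter (_∉? blocked b) X!)) include
          where
          include : ∀ {x} → x ∈ good → x ∈ filter (¬? ∘ (_<? l)) ys
          include x∈ = let x∈c , l≤ , <u = good∈⁻ x∈ in
            ∈-filter⁺ (¬? ∘ (_<? l)) {xs = ys} (∈-filter⁺ (_<? u) {xs = cands p} x∈c <u) (≤⇒≯ l≤)
        l≤u : l ≤ u
        l≤u = let _ , x∈ = nonempty-∈ {xs = good} (≤-<-trans z≤n many) ; _ , l≤ , <u = good∈⁻ x∈ in <⇒≤ (≤-<-trans l≤ <u)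
        below-l : below p l ≤ length (filter (_<? l) ys)
        below-l = Unique-⊆⇒length≤ (Unique-filter (_<? l) (cands! p)) include
          where
          include : ∀ {x} → x ∈ filter (_<? l) (cands p) → x ∈ filter (_<? l) ys
          include x∈ = let x∈c , <l = ∈-filter⁻ (_<? l) {xs = cands p} x∈ in
            ∈-filter⁺ (_<? l) {xs = ys} (∈-filter⁺ (_<? u) {xs = cands p} x∈c (<-≤-trans <l l≤u)) <l

      find-piece : ∀ {b} → b ∈ B → ∃ λ p → p ∈ S × below p (lowʳ (asc p) (lo p) b) + 2 * w ≤ below p (highʳ (asc p) (hi p) b)
      find-piece {b} b∈ =
        let p , p∈ , many = pigeonhole (inside? b) S (free b) (2 * w) (covered b∈) (free-large b)
        in p , p∈ , gap b p many

      below-small : ∀ p z → below p z < 8 * K * w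
      below-small p z = ≤-<-trans (≤-trans (length-filter (_<? z) (cands p)) (length-filter (insideˡ? p) X)) X-small

      bucket : ∀ k → k < 8 * K * w → ∃ λ j → j < 8 * K × j * w ≤ k × k < suc j * w
      bucket k k<8Kw = k / w , *-cancelʳ-< w (k / w) (8 * K) (≤-<-trans (m/n*n≤m k w) k<8Kw) , m/n*n≤m k w ,
        subst (_< w + k / w * w) (sym (m≡m%n+[m/n]*n k w)) (+-monoˡ-< (k / w * w) (m%n<n k w))
        where
        instance w≢0 : NonZero w
        w≢0 = >-nonZero 0<w

      coloured : ∀ {b} → b ∈ B → ∃ λ c → c ∈ colours × Colour b c
      coloured {b} b∈ =
        let p , p∈ , gap = find-piece b∈
            j , j< , ≤k , k< = bucket (below p (lowʳ (asc p) (lo p) b)) (below-small p _)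
        in (p , j) , ∈-cartesianProduct⁺ p∈ (∈-upTo⁺ j<) , gap , ≤k , k<

      record Selected : Set where
        field
          {p} : Piece
          {X′ B′} : List ℕ
          p∈ : p ∈ S
          X′! : Unique X′
          X′⊆ : ∀ {x} → x ∈ X′ → x ∈ X
          B′! : Unique B → Unique B′
          B′⊆ : ∀ {b} → b ∈ B′ → b ∈ B
          X′-large : w ≤ length X′
          B′-large : length B ≤ 8 * K * K * length B′
          inside : ∀ {x b} → x ∈ X′ → b ∈ B′ → Inside p (pick x) b x

      module Class (p : Piece) (j : ℕ) (p∈S : p ∈ S)
        (B≤ : length B ≤ length colours * length (filter (λ b → colour? b (p , j)) B)) where

        open ≤-Reasoning

        class : List ℕ
        class = filter (λ b → colour? b (p , j)) B

        class∈⁻ : ∀ {b} → b ∈ class → b ∈ B × Colour b (p , j)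
        class∈⁻ = ∈-filter⁻ (λ b → colour? b (p , j)) {xs = B}

        class≢[] : 0 < length class
        class≢[] = n≢0⇒n>0 λ eq → n≮0 (<-≤-trans B≢[] (≤-trans B≤ (≤-reflexive (trans (cong (length colours *_) eq) (*-zeroʳ (length colours))))))

        central? : ∀ x → Dec (All (λ b → Insideʳ p b x) class)
        central? x = all? (λ b → insideʳ? p b x) class

        colours-length : length colours ≤ 8 * K * K
        colours-length = begin
          length colours              ≡⟨ trans (length-cartesianProduct S _) (cong (length S *_) (length-upTo (8 * K))) ⟩
          length S * (8 * K)          ≤⟨ *-monoˡ-≤ (8 * K) S≤K ⟩
          K * (8 * K)                 ≡⟨ *-comm K (8 * K) ⟩
          8 * K * K                   ∎

        chosen : List ℕ
        chosen = filter central? (cands p)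

        chosen∈⁻ : ∀ {x} → x ∈ chosen → x ∈ X × Insideˡ p (pick x) x × All (λ b → Insideʳ p b x) class
        chosen∈⁻ x∈ =
          let x∈c , cen = ∈-filter⁻ central? {xs = cands p} x∈
              x∈X , ins = ∈-filter⁻ (insideˡ? p) {xs = X} x∈c
          in x∈X , ins , cen

        -- A candidate between the largest lower bound and the smallest upper bound suits the whole
        -- class. The former has rank below (j + 1)w, the latter rank at least (j + 2)w.
        chosen-large : w ≤ length chosen
        chosen-large =
          let b₁ , b₁∈ , b₁-max = extremum ≤-total ≤-trans (lowʳ (asc p) (lo p)) class class≢[]
              b₂ , b₂∈ , b₂-min = extremum {_≼_ = _≥_} (λ x y → ≤-total y x) (λ x≥y y≥z → ≤-trans y≥z x≥y) (highʳ (asc p) (hi p)) class class≢[]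
          in count b₁∈ b₁-max b₂∈ b₂-min
          where
          count : ∀ {b₁ b₂} → b₁ ∈ class → (∀ {b} → b ∈ class → lowʳ (asc p) (lo p) b ≤ lowʳ (asc p) (lo p) b₁) →
            b₂ ∈ class → (∀ {b} → b ∈ class → highʳ (asc p) (hi p) b₂ ≤ highʳ (asc p) (hi p) b) → w ≤ length chosen
          count {b₁} {b₂} b₁∈ b₁-max b₂∈ b₂-min = +-cancelˡ-≤ (suc j * w) _ _ (begin
            suc j * w + w                                                 ≡⟨ +-comm (suc j * w) w ⟩
            w + (w + j * w)                                               ≡⟨ +-assoc w w (j * w) ⟨
            w + w + j * w                                                 ≡⟨ +-comm (w + w) (j * w) ⟩
            j * w + (w + w)                                               ≡⟨ cong (λ z → j * w + (w + z)) (+-identityʳ w) ⟨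
            j * w + 2 * w                                                 ≤⟨ +-monoˡ-≤ (2 * w) (proj₁ (proj₂ col₂)) ⟩
            below p (lowʳ (asc p) (lo p) b₂) + 2 * w                      ≤⟨ proj₁ col₂ ⟩
            below p z₂                                                    ≤⟨ Unique-⊆⇒length≤ (Unique-filter (_<? z₂) (cands! p)) split ⟩
            length (filter (_<? z₁) (cands p) ++ chosen)                  ≡⟨ length-++ (filter (_<? z₁) (cands p)) ⟩
            below p z₁ + length chosen                                    ≤⟨ +-monoˡ-≤ (length chosen) (<⇒≤ (proj₂ (proj₂ (proj₂ (class∈⁻ b₁∈))))) ⟩
            suc j * w + length chosen                                     ∎)
            where
            col₂ = proj₂ (class∈⁻ b₂∈)
            z₁ = lowʳ (asc p) (lo p) b₁
            z₂ = highʳ (asc p) (hi p) b₂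
            split : ∀ {x} → x ∈ filter (_<? z₂) (cands p) → x ∈ filter (_<? z₁) (cands p) ++ chosen
            split {x} x∈ with x <? z₁
            ... | yes x<z₁ = ∈-++⁺ˡ (∈-filter⁺ (_<? z₁) {xs = cands p} (proj₁ (∈-filter⁻ (_<? z₂) {xs = cands p} x∈)) x<z₁)
            ... | no x≮z₁ =
              let x∈c , x<z₂ = ∈-filter⁻ (_<? z₂) {xs = cands p} x∈ in
              ∈-++⁺ʳ (filter (_<? z₁) (cands p)) (∈-filter⁺ central? {xs = cands p} x∈c
                (All.tabulate λ b∈ → ≤-trans (b₁-max b∈) (≮⇒≥ x≮z₁) , <-≤-trans x<z₂ (b₂-min b∈)))

        selected : Selected
        selected = record
          { p = p ; X′ = chosen ; B′ = class
          ; p∈ = p∈S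
          ; X′! = Unique-filter central? (cands! p)
          ; X′⊆ = λ x∈ → proj₁ (chosen∈⁻ x∈)
          ; B′! = Unique-filter (λ b → colour? b (p , j))
          ; B′⊆ = λ b∈ → proj₁ (class∈⁻ b∈)
          ; X′-large = chosen-large
          ; B′-large = ≤-trans B≤ (*-monoˡ-≤ (length class) colours-length)
          ; inside = λ x∈ b∈ → let _ , ins , cen = chosen∈⁻ x∈ in Inside-join p _ _ ins (All.lookup cen b∈)
          }

      select : Selected
      select =
        let (p , j) , c∈ , B≤ = popular colour? colours B B≢[] coloured
        in Class.selected p j (proj₁ (∈-cartesianProduct⁻ S (upTo (8 * K)) c∈)) B≤

-- One rotation for a whole family, with an account of the constant pieces.

module RotationSteps where

  open Prelude
  open Counting
  open SymbolicPaths
  open SymbolicRotations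
  open PivotSelection
  open import Data.Nat.Tactic.RingSolver using (solve-∀)
  open import Data.List.Relation.Unary.Any as Any using (any?)
  open import Data.List.Relation.Unary.All as All using ()
  open import Data.List.Relation.Unary.All.Properties as Allₚ using ()
  open import Data.List.Relation.Unary.Unique.Propositional.Properties as Uniqueₚ using ()

  -- Only pieces with two constant boundaries count: the edges inside them are traversed in the same
  -- direction by all paths of a family.
  constLen : Piece → ℕ
  constLen (piece _ (const c) (const d)) = d ∸ c
  constLen _ = 0

  constLength : List Piece → ℕ
  constLength []      = 0
  constLength (p ∷ S) = constLen p + constLength S

  constLength-++ : ∀ Q R → constLength (Q ++ R) ≡ constLength Q + constLength R
  constLength-++ []      R = refl
  constLength-++ (p ∷ Q) R = trans (cong (constLen p +_) (constLength-++ Q R)) (sym (+-assoc (constLen p) _ _))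

  constLength-map : ∀ f → (∀ p → constLen (f p) ≡ constLen p) → ∀ S → constLength (map f S) ≡ constLength S
  constLength-map f eq []      = refl
  constLength-map f eq (p ∷ S) = cong₂ _+_ (eq p) (constLength-map f eq S)

  constLen-flip : ∀ p → constLen (flip p) ≡ constLen p
  constLen-flip (piece _ (const _) (const _)) = refl
  constLen-flip (piece _ (const _) (left _))  = refl
  constLen-flip (piece _ (const _) (right _)) = refl
  constLen-flip (piece _ (left _) _)  = refl
  constLen-flip (piece _ (right _) _) = refl

  constLen-reindex : ∀ h p → constLen (reindexPiece h p) ≡ constLen p
  constLen-reindex h (piece _ (const _) (const _)) = refl
  constLen-reindex h (piece _ (const _) (left _))  = refl
  constLen-reindex h (piece _ (const _) (right _)) = refl
  constLen-reindex h (piece _ (left _) _)  = refl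
  constLen-reindex h (piece _ (right _) _) = refl

  constLength-rev : ∀ S → constLength (rev S) ≡ constLength S
  constLength-rev []      = refl
  constLength-rev (p ∷ S) = begin
    constLength (reverse (flip p ∷ map flip S))    ≡⟨ cong constLength (unfold-reverse (flip p) (map flip S)) ⟩
    constLength (rev S ++ flip p ∷ [])             ≡⟨ constLength-++ (rev S) _ ⟩
    constLength (rev S) + (constLen (flip p) + 0)  ≡⟨ cong₂ _+_ (constLength-rev S) (trans (+-identityʳ _) (constLen-flip p)) ⟩
    constLength S + constLen p                     ≡⟨ +-comm (constLength S) _ ⟩
    constLen p + constLength S                     ∎
    where open ≡-Reasoning

  swapCut : Cut → Cut
  swapCut (const c) = const c
  swapCut (left f)  = right f
  swapCut (right f) = left f

  swapPiece : Piece → Piece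
  swapPiece (piece s l u) = piece s (swapCut l) (swapCut u)

  -- Reversing the paths exchanges the two ends, so that rotations at b become rotations at a.
  mirror : List Piece → List Piece
  mirror S = rev (map swapPiece S)

  path-swap : ∀ S a b → path (map swapPiece S) b a ≡ path S a b
  path-swap []                a b = refl
  path-swap (piece s l u ∷ S) a b = cong₂ _++_ (cong₂ (interval s) (swapped l) (swapped u)) (path-swap S a b)
    where
    swapped : ∀ c → ⟦ swapCut c ⟧ b a ≡ ⟦ c ⟧ a b
    swapped (const _) = refl
    swapped (left _)  = refl
    swapped (right _) = refl

  constLen-swap : ∀ p → constLen (swapPiece p) ≡ constLen p
  constLen-swap (piece _ (const _) (const _)) = refl
  constLen-swap (piece _ (const _) (left _))  = refl
  constLen-swap (piece _ (const _) (right _)) = refl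
  constLen-swap (piece _ (left _) _)  = refl
  constLen-swap (piece _ (right _) _) = refl

  length-rev : ∀ S → length (rev S) ≡ length S
  length-rev S = trans (length-reverse (map flip S)) (length-map flip S)

  constLen-before : ∀ p → constLen (before p (newCut (asc p))) ≡ 0
  constLen-before (piece true (const _) u) = refl
  constLen-before (piece true (left _)  u) = refl
  constLen-before (piece true (right _) u) = refl
  constLen-before (piece false l u) = refl

  constLen-after : ∀ p → constLen (after p (newCut (asc p))) ≡ 0
  constLen-after (piece true l u) = refl
  constLen-after (piece false (const _) u) = refl
  constLen-after (piece false (left _)  u) = refl
  constLen-after (piece false (right _) u) = refl

  Short : ℕ → Piece → Set
  Short ℓ p = constLen p ≤ ℓ

  Short-map : ∀ {ℓ} f → (∀ p → constLen (f p) ≡ constLen p) → ∀ {S} → All (Short ℓ) S → All (Short ℓ) (map f S)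
  Short-map f eq sh = Allₚ.map⁺ (All.map (λ {p} → ≤-trans (≤-reflexive (eq p))) sh)

  Short-rev : ∀ {ℓ S} → All (Short ℓ) S → All (Short ℓ) (rev S)
  Short-rev sh = All-resp-↭ (↭-sym (↭-reverse _)) (Short-map flip constLen-flip sh)

  -- Shape k ℓ t S: after t rotations of a path cut into k constant pieces of length at most ℓ.
  record Shape (m k ℓ t : ℕ) (S : List Piece) : Set where
    field
      pieces : length S ≤ k + t
      fixed  : m ≤ constLength S + t * ℓ
      short  : All (Short ℓ) S
  open Shape public

  mirror-shape : ∀ {m k ℓ t S} → Shape m k ℓ t S → Shape m k ℓ t (mirror S)
  mirror-shape {S = S} sh = record
    { pieces = ≤-trans (≤-reflexive (trans (length-rev (map swapPiece S)) (length-map swapPiece S))) (pieces sh)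
    ; fixed = ≤-trans (fixed sh) (≤-reflexive (cong (_+ _) (sym (trans (constLength-rev (map swapPiece S)) (constLength-map swapPiece constLen-swap S)))))
    ; short = Short-rev (Short-map swapPiece constLen-swap (short sh))
    }

  -- Only p is cut. Both of its parts are bounded by the new cut, which depends on the endpoint, so
  -- at most ℓ constant positions are lost; reversal and reindexing keep all other constant pieces
  -- constant.
  rotated-shape : ∀ {m k ℓ t} h Q p R → Shape m k ℓ t (Q ++ p ∷ R) → Shape m k ℓ (suc t) (rotated h Q p R)
  rotated-shape {m} {k} {ℓ} {t} h Q p R sh = record
    { pieces = begin
        length (rotated h Q p R)                             ≡⟨ cong suc (length-++ (rev Q′)) ⟩
        suc (length (rev Q′) + suc (length R′))              ≡⟨ cong suc (cong₂ _+_ (trans (length-rev Q′) (length-map _ Q)) (cong suc (length-map _ R))) ⟩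
        suc (length Q + suc (length R))                      ≡⟨ cong suc (length-++ Q) ⟨
        suc (length (Q ++ p ∷ R))                            ≤⟨ s≤s (pieces sh) ⟩
        suc (k + t)                                          ≡⟨ +-suc k t ⟨
        k + suc t                                            ∎
    ; fixed = begin
        m                                                    ≤⟨ fixed sh ⟩
        constLength (Q ++ p ∷ R) + t * ℓ                     ≡⟨ cong (_+ t * ℓ) (constLength-++ Q (p ∷ R)) ⟩
        constLength Q + (constLen p + constLength R) + t * ℓ ≤⟨ +-monoˡ-≤ (t * ℓ) (+-monoʳ-≤ (constLength Q) (+-monoˡ-≤ (constLength R) p≤)) ⟩
        constLength Q + (ℓ + constLength R) + t * ℓ          ≡⟨ cong (λ z → constLength Q + z + t * ℓ) (+-comm ℓ (constLength R)) ⟩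
        constLength Q + (constLength R + ℓ) + t * ℓ          ≡⟨ cong (_+ t * ℓ) (+-assoc (constLength Q) (constLength R) ℓ) ⟨
        constLength Q + constLength R + ℓ + t * ℓ            ≡⟨ +-assoc (constLength Q + constLength R) ℓ (t * ℓ) ⟩
        constLength Q + constLength R + (ℓ + t * ℓ)          ≡⟨ cong (_+ (ℓ + t * ℓ)) rot ⟨
        constLength (rotated h Q p R) + suc t * ℓ            ∎
    ; short = ≤-trans (≤-reflexive bef) z≤n ∷
        Allₚ.++⁺ (Short-rev (Short-map (reindexPiece h) (constLen-reindex h) (Allₚ.++⁻ˡ Q (short sh))))
          (≤-trans (≤-reflexive aft) z≤n ∷ Short-map (reindexPiece h) (constLen-reindex h) (All.tail (Allₚ.++⁻ʳ Q (short sh))))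
    }
    where
    open ≤-Reasoning
    Q′ = map (reindexPiece h) Q
    R′ = map (reindexPiece h) R
    p≤ : constLen p ≤ ℓ
    p≤ = All.head (Allₚ.++⁻ʳ Q (short sh))
    bef : constLen (flip (before (reindexPiece h p) (newCut (asc p)))) ≡ 0
    bef = trans (constLen-flip (before (reindexPiece h p) (newCut (asc p)))) (constLen-before (reindexPiece h p))
    aft : constLen (after (reindexPiece h p) (newCut (asc p))) ≡ 0
    aft = constLen-after (reindexPiece h p)
    rot : constLength (rotated h Q p R) ≡ constLength Q + constLength R
    rot = trans (cong₂ _+_ bef (constLength-++ (rev Q′) _))
      (cong₂ _+_ (trans (constLength-rev Q′) (constLength-map (reindexPiece h) (constLen-reindex h) Q))
        (cong₂ _+_ aft (constLength-map (reindexPiece h) (constLen-reindex h) R)))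

  -- `entryPoint` is the predecessor of the pivot in the direction of traversal, that is, the new
  -- endpoint; `exitPoint` recovers the pivot from it.
  entryPoint exitPoint : Bool → ℕ → ℕ
  entryPoint true  x = x ∸ 1
  entryPoint false x = suc x
  exitPoint true  a = suc a
  exitPoint false a = a ∸ 1

  module Steps (m : ℕ) (E : ℕ → ℕ → Set) (E? : ∀ x y → Dec (E x y)) (E-sym : ∀ {x y} → E x y → E y x) where

    open Walks E
    open Rotations m E E-sym
    open Selection m

    adjacent? : ∀ A x → Dec (Any.Any (λ a → E a x) A)
    adjacent? A x = any? (λ a → E? a x) A

    nbrs : List ℕ → List ℕ
    nbrs A = filter (adjacent? A) (upTo m)

    -- A definite choice of old endpoint for each pivot, so that a pivot determines the path to be
    -- rotated. The value 0 arises only if no member of A is adjacent to x.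
    pick : List ℕ → ℕ → ℕ
    pick []      x = 0
    pick (a ∷ A) x with E? a x
    ... | yes _ = a
    ... | no  _ = pick A x

    pick-adjacent : ∀ A {x} → Any.Any (λ a → E a x) A → pick A x ∈ A × E (pick A x) x
    pick-adjacent (a ∷ A) {x} adj with E? a x
    ... | yes e = here refl , e
    pick-adjacent (a ∷ A) (here e)    | no ¬e = ⊥-elim (¬e e)
    pick-adjacent (a ∷ A) (there adj) | no _  = let p , e = pick-adjacent A adj in there p , e

    nbrs∈⁻ : ∀ A {x} → x ∈ nbrs A → pick A x ∈ A × E (pick A x) x × x < m
    nbrs∈⁻ A x∈ = let x∈m , adj = ∈-filter⁻ (adjacent? A) {xs = upTo m} x∈ ; p , e = pick-adjacent A adj in p , e , ∈-upTo⁻ x∈m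

    record Family (A B : List ℕ) (S : List Piece) : Set where
      field
        A! : Unique A
        B! : Unique B
        spans : ∀ {a b} → a ∈ A → b ∈ B → Spans a b (path S a b)
    open Family public

    mirror-family : ∀ {A B S} → Family A B S → Family B A (mirror S)
    mirror-family {S = S} F = record
      { A! = B! F ; B! = A! F
      ; spans = λ {b} {a} b∈ a∈ → let w , perm = spans F a∈ b∈ in
          subst (Spans b a) (sym (trans (path-rev (map swapPiece S) b a) (cong reverse (path-swap S a b))))
            (walk-reverse E-sym w , ↭-trans (↭-reverse _) perm)
      }

    restrict : ∀ {A B A′ B′ S} → Unique A′ → (∀ {a} → a ∈ A′ → a ∈ A) → Unique B′ → (∀ {b} → b ∈ B′ → b ∈ B) →
      Family A B S → Family A′ B′ S
    restrict A′! A′⊆ B′! B′⊆ F = record { A! = A′! ; B! = B′! ; spans = λ a∈ b∈ → spans F (A′⊆ a∈) (B′⊆ b∈) }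

    exit-entry : ∀ p a b {x} → Inside p a b x → exitPoint (asc p) (entryPoint (asc p) x) ≡ x
    exit-entry (piece true  l u) a b (s≤s _ , _) = refl
    exit-entry (piece false l u) a b _ = refl

    rotate-family : ∀ {A B X′ B′ k ℓ t} Q p R → Family A B (Q ++ p ∷ R) → Shape m k ℓ t (Q ++ p ∷ R) →
      Unique X′ → (∀ {x} → x ∈ X′ → x ∈ nbrs A) → Unique B′ → (∀ {b} → b ∈ B′ → b ∈ B) → 0 < length B′ →
      (∀ {x b} → x ∈ X′ → b ∈ B′ → Inside p (pick A x) b x) →
      ∃ λ S′ → Family (map (entryPoint (asc p)) X′) B′ S′ × Shape m k ℓ (suc t) S′
    rotate-family {A} {B} {X′} {B′} Q p R F sh X′! X′⊆ B′! B′⊆ B′≢[] inside = rotated back Q p R , record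
        { A! = Uniqueₚ.map⁻ {f = exitPoint (asc p)} (subst Unique (sym round-trip) X′!)
        ; B! = B′!
        ; spans = λ a∈ b∈ → let x , x∈ , a≡ = ∈-map⁻ (entryPoint (asc p)) a∈ in rotate x∈ b∈ a≡
        } , rotated-shape back Q p R sh
      where
      -- From the new endpoint to its pivot, and from there to the old endpoint.
      back : ℕ → ℕ
      back a = pick A (exitPoint (asc p) a)
      b₀ = nonempty-∈ B′≢[]
      -- The truncated predecessor is not injective at 0, but a pivot inside an ascending piece is
      -- positive, so it can be recovered.
      round-trip : map (exitPoint (asc p)) (map (entryPoint (asc p)) X′) ≡ X′
      round-trip = trans (sym (map-∘ X′)) (map-id-local (All.tabulate λ x∈ → exit-entry p _ _ (inside x∈ (proj₂ b₀))))
      turn : ∀ q {c b x a} → a ≡ entryPoint (asc q) x → Inside q c b x → ∃ λ y →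
        a ≡ endpoint (asc q) y × pivot (asc q) y ≡ x × ⟦ lo q ⟧ c b ≤ y × suc y < ⟦ hi q ⟧ c b
      turn (piece true  l u) refl (s≤s l≤ , <u) = _ , refl , refl , l≤ , <u
      turn (piece false l u) {c} {b} {x} refl (l≤ , <u) = x , refl , refl , l≤ , m<n∸o⇒o+m<n′ <u
        where
        m<n∸o⇒o+m<n′ : ∀ {v} → x < v ∸ 1 → suc x < v
        m<n∸o⇒o+m<n′ {suc v} x<v = s≤s x<v
      rotate : ∀ {x b a} → x ∈ X′ → b ∈ B′ → a ≡ entryPoint (asc p) x → Spans a b (path (rotated back Q p R) a b)
      rotate {x} {b} {a} x∈ b∈ a≡ with turn p a≡ (inside x∈ b∈)
      ... | y , a≡y , piv , l≤ , <u =
        let c∈ , e , _ = nbrs∈⁻ A (X′⊆ x∈) in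
        rotated-spans Q p R back y
          (cong (pick A) (trans (cong (exitPoint (asc p)) a≡) (exit-entry p _ _ (inside x∈ b∈))))
          a≡y l≤ <u (subst (E (pick A x)) (sym piv) e) (spans F c∈ (B′⊆ b∈))

    record Stepped (A B : List ℕ) (k ℓ t K : ℕ) : Set where
      field
        {A′ B′} : List ℕ
        {S′} : List Piece
        family : Family A′ B′ S′
        shape : Shape m k ℓ (suc t) S′
        A′-large : length (nbrs A) ≤ 8 * K * length A′
        B′-large : length B ≤ 8 * K * K * length B′
        B′-small : length B′ ≤ length B

    step : ∀ {A B S k ℓ t} K → Family A B S → Shape m k ℓ t S → 0 < length A → 0 < length B → 0 < K → k + t ≤ K →
      16 * K * length A ≤ length (nbrs A) → Stepped A B k ℓ t K
    step {A} {B} {S} {k} {ℓ} {t} K F sh A≢[] B≢[] 0<K k+t≤K X≥ =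
      let Q , R , S≡ = ∈-∃++ p∈
          S′ , F′ , sh′ = rotate-family Q p R (subst (Family A B) S≡ F) (subst (Shape m k ℓ t) S≡ sh) X′! X′⊆ (B′! (B! F)) B′⊆ B′≢[] inside
      in record
        { family = F′ ; shape = sh′
        ; A′-large = begin
            length X                                        ≤⟨ <⇒≤ X-small ⟩
            8 * K * w                                       ≤⟨ *-monoʳ-≤ (8 * K) X′-large ⟩
            8 * K * length X′                               ≡⟨ cong (8 * K *_) (length-map _ X′) ⟨
            8 * K * length (map (entryPoint (asc p)) X′)    ∎
        ; B′-large = B′-large
        ; B′-small = Unique-⊆⇒length≤ (B′! (B! F)) B′⊆
        }
      where
      open ≤-Reasoning
      X = nbrs A
      instance
        K≢0 : NonZero K
        K≢0 = >-nonZero 0<K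
        4K≢0 : NonZero (4 * K)
        4K≢0 = m*n≢0 4 K
      -- With this w, 2w pivots for each of K pieces use at most half of X, and by 16K|A| ≤ |X| the
      -- excluded entries use at most an eighth.
      w = length X / (4 * K)
      N = length A
      0<KN : 0 < K * N
      0<KN = *-mono-≤ 0<K A≢[]
      X≥′ : 16 * (K * N) ≤ length X
      X≥′ = ≤-trans (≤-reflexive (sym (*-assoc 16 K N))) X≥
      X-large : suc N * K + K * (2 * w) < length X
      X-large = *-cancelˡ-< 2 _ _ (begin-strict
        2 * (suc N * K + K * (2 * w))           ≤⟨ *-monoʳ-≤ 2 (+-monoˡ-≤ (K * (2 * w)) (*-monoˡ-≤ K (+-monoˡ-≤ N A≢[]))) ⟩
        2 * ((N + N) * K + K * (2 * w))         ≡⟨ doubled N K w ⟩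
        4 * (K * N) + w * (4 * K)               <⟨ +-monoˡ-< (w * (4 * K)) (*-monoˡ-< (K * N) {{>-nonZero 0<KN}} {4} {16} (s≤s (s≤s (s≤s (s≤s z<s))))) ⟩
        16 * (K * N) + w * (4 * K)              ≤⟨ +-mono-≤ X≥′ (m/n*n≤m (length X) (4 * K)) ⟩
        length X + length X                     ≡⟨ cong (length X +_) (+-identityʳ (length X)) ⟨
        2 * length X                            ∎)
        where
        doubled : ∀ N K w → 2 * ((N + N) * K + K * (2 * w)) ≡ 4 * (K * N) + w * (4 * K)
        doubled = solve-∀
      1≤w : 1 ≤ w
      1≤w = m≥n⇒m/n>0 (begin
        4 * K               ≡⟨ *-identityʳ (4 * K) ⟨
        4 * K * 1           ≤⟨ *-mono-≤ (*-monoˡ-≤ K {4} {16} (s≤s (s≤s (s≤s (s≤s z≤n))))) A≢[] ⟩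
        16 * K * N          ≤⟨ X≥ ⟩
        length X            ∎)
      X-small : length X < 8 * K * w
      X-small = begin-strict
        length X                                  ≡⟨ m≡m%n+[m/n]*n (length X) (4 * K) ⟩
        length X % (4 * K) + w * (4 * K)          <⟨ +-monoˡ-< (w * (4 * K)) (m%n<n (length X) (4 * K)) ⟩
        4 * K + w * (4 * K)                       ≤⟨ +-monoˡ-≤ (w * (4 * K)) (≤-trans (≤-reflexive (sym (+-identityʳ (4 * K)))) (*-monoˡ-≤ (4 * K) 1≤w)) ⟩
        w * (4 * K) + w * (4 * K)                 ≡⟨ tripled K w ⟩
        8 * K * w                                 ∎
        where
        tripled : ∀ K w → w * (4 * K) + w * (4 * K) ≡ 8 * K * w
        tripled = solve-∀
      sel = select S A B X (pick A) K w
        (Uniqueₚ.filter⁺ (adjacent? A) (Uniqueₚ.upTo⁺ m)) B≢[]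
        (λ x∈ → proj₁ (nbrs∈⁻ A x∈)) (λ x∈ → proj₂ (proj₂ (nbrs∈⁻ A x∈)))
        (λ x∈ b∈ → ∈-resp-↭ (↭-sym (proj₂ (spans F (proj₁ (nbrs∈⁻ A x∈)) b∈))) (∈-upTo⁺ (proj₂ (proj₂ (nbrs∈⁻ A x∈)))))
        (≤-trans (pieces sh) k+t≤K) X-large X-small
      open Selected sel
      B′≢[] : 0 < length B′
      B′≢[] = n≢0⇒n>0 λ eq → n≮0 (<-≤-trans B≢[] (≤-trans B′-large (≤-reflexive (trans (cong (8 * K * K *_) eq) (*-zeroʳ (8 * K * K))))))

-- Growth of both endpoint sets in rounds.

module EndpointGrowth where

  open Prelude
  open Counting
  open SymbolicPaths
  open SymbolicRotations
  open PivotSelection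
  open RotationSteps
  open import Data.Nat.Tactic.RingSolver using (solve-∀)
  open import Data.List.Relation.Unary.Unique.Propositional.Properties as Uniqueₚ using ()

  ∈-take : {A : Set} {x : A} (s : ℕ) (xs : List A) → x ∈ take s xs → x ∈ xs
  ∈-take (suc s) (y ∷ xs) (here refl) = here refl
  ∈-take (suc s) (y ∷ xs) (there x∈)  = there (∈-take s xs x∈)

  length-take-≤ : {A : Set} (s : ℕ) (xs : List A) → s ≤ length xs → length (take s xs) ≡ s
  length-take-≤ s xs s≤ = trans (length-take s xs) (m≤n⇒m⊓n≡m s≤)

  -- The factor 15 comes from the expansion of small sets, 8 K and 8 K * K from the pigeonholes of a rotation step.
  loss : ℕ → ℕ
  loss K = 15 * (8 * K * (8 * K * K))

  module Growth (m : ℕ) (E : ℕ → ℕ → Set) (E? : ∀ x y → Dec (E x y)) (E-sym : ∀ {x y} → E x y → E y x) where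

    open Walks E
    open Rotations m E E-sym
    open Steps m E E? E-sym

    -- Expansion will be required of sets of such ends only: their neighbours cannot leave a longest
    -- path, so counting positions captures the whole neighbourhood.
    EndPoint : ℕ → Set
    EndPoint a = ∃ λ b → ∃ λ xs → Spans a b xs

    endPoints : ∀ {A B S} → Family A B S → 0 < length B → ∀ {a} → a ∈ A → EndPoint a
    endPoints F B≢[] a∈ = let b , b∈ = nonempty-∈ B≢[] in b , _ , spans F a∈ b∈

    -- D and M stand for the powers of log n in the expansion of the small sets.
    module _ (n k ℓ K D M g : ℕ) (0<K : 0 < K) (0<g : 0 < g) (D-large : loss K * g ≤ D)
      (expands : ∀ U → Unique U → (∀ {u} → u ∈ U → EndPoint u) → length U * M ≤ n → length U * D ≤ 15 * length (nbrs U)) where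

      record Large (s t : ℕ) : Set where
        constructor large
        field
          {A B} : List ℕ
          {S} : List Piece
          family : Family A B S
          shape : Shape m k ℓ t S
          A≥ : s ≤ length A
          B≥ : s ≤ length B

      instance
        K≢0 : NonZero K
        K≢0 = >-nonZero 0<K
        g≢0 : NonZero g
        g≢0 = >-nonZero 0<g

      nbrs-large : ∀ a X → a * D ≤ 15 * X → 16 * K * a ≤ X
      nbrs-large a X aD≤ = *-cancelˡ-≤ 15 (begin
        15 * (16 * K * a)               ≡⟨ *-assoc 15 (16 * K) a ⟨
        15 * (16 * K) * a               ≤⟨ *-monoˡ-≤ a (begin
          15 * (16 * K)                   ≤⟨ *-monoʳ-≤ 15 16K≤ ⟩
          15 * (8 * K * (8 * K * K))      ≤⟨ m≤m*n _ g ⟩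
          15 * (8 * K * (8 * K * K)) * g  ≤⟨ D-large ⟩
          D                               ∎) ⟩
        D * a                           ≡⟨ *-comm D a ⟩
        a * D                           ≤⟨ aD≤ ⟩
        15 * X                          ∎)
        where
        open ≤-Reasoning
        16K≤ : 16 * K ≤ 8 * K * (8 * K * K)
        16K≤ = begin
          16 * K                ≡⟨ *-assoc 2 8 K ⟩
          2 * (8 * K)           ≡⟨ *-comm 2 (8 * K) ⟩
          8 * K * 2             ≤⟨ *-monoʳ-≤ (8 * K) (≤-trans (s≤s (s≤s z≤n)) (≤-trans (m≤m*n 8 K) (m≤m*n (8 * K) K))) ⟩
          8 * K * (8 * K * K)   ∎

      -- `small` keeps the other side within the range of the expansion hypothesis, since it is the
      -- side rotated next.
      record HalfRound (a b t : ℕ) : Set where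
        constructor half-round
        field
          {A B} : List ℕ
          {S} : List Piece
          family : Family A B S
          shape : Shape m k ℓ (suc t) S
          gain : a * D ≤ 15 * (8 * K * length A)
          toll : b ≤ 8 * K * K * length B
          small : length B ≤ b

      half : ∀ {A B S t} → Family A B S → Shape m k ℓ t S → 0 < length A → 0 < length B → length A * M ≤ n → k + t ≤ K →
        HalfRound (length A) (length B) t
      half {A} {B} F sh A≢[] B≢[] AM≤n k+t≤K =
        half-round (Stepped.family st) (Stepped.shape st) (≤-trans exp (*-monoʳ-≤ 15 (Stepped.A′-large st))) (Stepped.B′-large st) (Stepped.B′-small st)
        where
        exp : length A * D ≤ 15 * length (nbrs A)
        exp = expands A (A! F) (endPoints F B≢[]) AM≤n
        st = step K F sh A≢[] B≢[] 0<K k+t≤K (nbrs-large (length A) (length (nbrs A)) exp)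

      loss≢0 : NonZero (loss K)
      loss≢0 = m*n≢0 15 (8 * K * (8 * K * K)) {{_}} {{m*n≢0 (8 * K) (8 * K * K) {{m*n≢0 8 K}} {{m*n≢0 (8 * K) K {{m*n≢0 8 K}}}}}}

      gained : ∀ s y → s * D ≤ loss K * y → g * s ≤ y
      gained s y sD≤ = *-cancelˡ-≤ (loss K) {{loss≢0}} (begin
        loss K * (g * s)       ≡⟨ *-assoc (loss K) g s ⟨
        loss K * g * s         ≤⟨ *-monoˡ-≤ s D-large ⟩
        D * s             ≡⟨ *-comm D s ⟩
        s * D             ≤⟨ sD≤ ⟩
        loss K * y             ∎)
        where open ≤-Reasoning

      -- In a round each side gains once and pays once, A in this order and B in the opposite one;
      -- in both cases the net factor is D / `loss K`, at least g.
      gain-toll : ∀ s x y → s * D ≤ 15 * (8 * K * x) → x ≤ 8 * K * K * y → g * s ≤ y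
      gain-toll s x y gain toll = gained s y (begin
        s * D                             ≤⟨ gain ⟩
        15 * (8 * K * x)                  ≤⟨ *-monoʳ-≤ 15 (*-monoʳ-≤ (8 * K) toll) ⟩
        15 * (8 * K * (8 * K * K * y))    ≡⟨ cong (15 *_) (*-assoc (8 * K) (8 * K * K) y) ⟨
        15 * (8 * K * (8 * K * K) * y)    ≡⟨ *-assoc 15 (8 * K * (8 * K * K)) y ⟨
        loss K * y                             ∎)
        where open ≤-Reasoning

      toll-gain : ∀ s x y → s ≤ 8 * K * K * x → x * D ≤ 15 * (8 * K * y) → g * s ≤ y
      toll-gain s x y toll gain = gained s y (begin
        s * D                             ≤⟨ *-monoˡ-≤ D toll ⟩
        8 * K * K * x * D                 ≡⟨ *-assoc (8 * K * K) x D ⟩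
        8 * K * K * (x * D)               ≤⟨ *-monoʳ-≤ (8 * K * K) gain ⟩
        8 * K * K * (15 * (8 * K * y))    ≡⟨ regroup (8 * K * K) 15 (8 * K) y ⟩
        loss K * y                             ∎)
        where
        open ≤-Reasoning
        regroup : ∀ p q r y → p * (q * (r * y)) ≡ q * (r * p) * y
        regroup = solve-∀

      factor-positive : ∀ p {x y} → 0 < x → x ≤ p * y → 0 < y
      factor-positive p {y = zero}  0<x x≤ = subst (0 <_) (*-zeroʳ p) (<-≤-trans 0<x x≤)
      factor-positive p {y = suc y} _   _  = z<s

      round : ∀ {s t} → 0 < s → s * M ≤ n → k + suc t ≤ K → Large s t → Large (g * s) (suc (suc t))
      round {s} {t} 0<s sM≤n k+t<K (large {A} {B} {S} F sh A≥ B≥) =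
        second (subst₂ (λ a b → HalfRound a b t) A₀≡s B₀≡s
          (half F₀ sh (subst (0 <_) (sym A₀≡s) 0<s) (subst (0 <_) (sym B₀≡s) 0<s) (subst (λ z → z * M ≤ n) (sym A₀≡s) sM≤n)
            (≤-trans (+-monoʳ-≤ k (n≤1+n t)) k+t<K)))
        where
        A₀≡s : length (take s A) ≡ s
        A₀≡s = length-take-≤ s A A≥
        B₀≡s : length (take s B) ≡ s
        B₀≡s = length-take-≤ s B B≥
        -- Trimming both sides to exactly s elements makes the expansion of small sets applicable in
        -- both halves of the round.
        F₀ : Family (take s A) (take s B) S
        F₀ = restrict (Uniqueₚ.take⁺ s (A! F)) (∈-take s A) (Uniqueₚ.take⁺ s (B! F)) (∈-take s B) F
        second : HalfRound s s t → Large (g * s) (suc (suc t))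
        second (half-round {A₁} {B₁} F₁ sh₁ gain₁ toll₁ small₁) =
          third (half (mirror-family F₁) (mirror-shape sh₁) (factor-positive (8 * K * K) 0<s toll₁) A₁≢[]
            (≤-trans (*-monoˡ-≤ M small₁) sM≤n) k+t<K)
          where
          gs-positive : 0 < g * s
          gs-positive = *-mono-≤ 0<g 0<s
          A₁≢[] : 0 < length A₁
          A₁≢[] = n≢0⇒n>0 λ eq → n≮0 (<-≤-trans gs-positive (gain-toll s (length A₁) 0 gain₁ (≤-trans (≤-reflexive eq) z≤n)))
          third : HalfRound (length B₁) (length A₁) (suc t) → Large (g * s) (suc (suc t))
          third (half-round {B₂} {A₂} F₂ sh₂ gain₂ toll₂ _) = large (mirror-family F₂) (mirror-shape sh₂)
            (gain-toll s (length A₁) (length A₂) gain₁ toll₂) (toll-gain s (length B₁) (length B₂) toll₁ gain₂)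

      weaken : ∀ {s s′ t} → s′ ≤ s → Large s t → Large s′ t
      weaken s′≤s (large F sh A≥ B≥) = large F sh (≤-trans s′≤s A≥) (≤-trans s′≤s B≥)

      -- The cap T marks the end of the range in which small sets are known to expand; every round
      -- starts from sets trimmed to at most T.
      rounds : ∀ T → 0 < T → T * M ≤ n → ∀ j → k + 2 * j ≤ K → Large 1 0 → Large (g ^ j ⊓ T) (2 * j)
      rounds T 0<T TM≤n zero    _    start = weaken (m⊓n≤m 1 T) start
      rounds T 0<T TM≤n (suc j) k+j≤ start = subst (Large _) (cong suc (sym (+-suc j (j + 0))))
          (weaken grow (round (⊓-glb (m^n>0 g j) 0<T) (≤-trans (*-monoˡ-≤ M (m⊓n≤n (g ^ j) T)) TM≤n) (≤-trans (+-monoʳ-≤ k (≤-trans (n≤1+n _) (≤-reflexive (cong suc (sym (+-suc j (j + 0))))))) k+j≤)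
            (rounds T 0<T TM≤n j (≤-trans (+-monoʳ-≤ k (*-monoʳ-≤ 2 (n≤1+n j))) k+j≤) start)))
        where
        grow : g ^ suc j ⊓ T ≤ g * (g ^ j ⊓ T)
        grow = ≤-trans (⊓-monoʳ-≤ (g ^ suc j) (m≤n*m T g)) (≤-reflexive (sym (*-distribˡ-⊓ g (g ^ j) T)))

      -- Here the result is not capped: the sets of size T still expand, and g * T is meant to reach
      -- the range where neighbourhoods exceed one half.
      final-round : ∀ T R → 0 < T → T * M ≤ n → T ≤ g ^ R → k + 2 * suc R ≤ K → Large 1 0 → Large (g * T) (2 * suc R)
      final-round T R 0<T TM≤n T≤gᴿ k+R≤ start = subst (Large _) (cong suc (sym (+-suc R (R + 0))))
        (round 0<T TM≤n (≤-trans (+-monoʳ-≤ k (≤-trans (n≤1+n _) (≤-reflexive (cong suc (sym (+-suc R (R + 0))))))) k+R≤)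
          (subst (λ s → Large s (2 * R)) (m≥n⇒m⊓n≡n T≤gᴿ) (rounds T 0<T TM≤n R (≤-trans (+-monoʳ-≤ k (*-monoʳ-≤ 2 (n≤1+n R))) k+R≤) start)))

-- Closing a path at an edge inside a constant piece.

module ClosingUp where

  open Prelude
  open Counting
  open SymbolicPaths
  open SymbolicRotations
  open PivotSelection
  open RotationSteps
  open EndpointGrowth
  open import Data.Nat.Tactic.RingSolver using (solve-∀)
  open import Data.List.Membership.DecPropositional _≟_ using (_∈?_; _∉?_)
  open import Data.List.Relation.Binary.Sublist.Propositional using ([]; _∷_; minimum) renaming (_⊆_ to Sublist; _∷ʳ_ to skip)
  open import Data.List.Relation.Binary.Sublist.Propositional.Properties as Subₚ using ()
  open import Data.List.Relation.Unary.Unique.Propositional.Properties as Uniqueₚ using ()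

  Unique-resp-Sublist : {A : Set} {xs ys : List A} → Sublist xs ys → Unique ys → Unique xs
  Unique-resp-Sublist []           []       = []
  Unique-resp-Sublist (skip y τ)     (_ ∷ u)  = Unique-resp-Sublist τ u
  Unique-resp-Sublist (refl ∷ τ)   (y∉ ∷ u) = Subₚ.All-resp-⊆ τ y∉ ∷ Unique-resp-Sublist τ u

  filter-Sublist : {A : Set} {P : A → Set} (P? : ∀ x → Dec (P x)) (xs : List A) → Sublist (filter P? xs) xs
  filter-Sublist P? []       = []
  filter-Sublist P? (x ∷ xs) with P? x
  ... | yes _ = refl ∷ filter-Sublist P? xs
  ... | no  _ = skip x (filter-Sublist P? xs)

  pairs : List ℕ → List (ℕ × ℕ)
  pairs (x ∷ y ∷ zs) = (x , y) ∷ pairs (y ∷ zs)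
  pairs _            = []

  pairs-firsts : ∀ zs → Sublist (map proj₁ (pairs zs)) zs
  pairs-firsts []           = []
  pairs-firsts (x ∷ [])     = skip x []
  pairs-firsts (x ∷ y ∷ zs) = refl ∷ pairs-firsts (y ∷ zs)

  pairs-seconds : ∀ z zs → Sublist (map proj₂ (pairs (z ∷ zs))) zs
  pairs-seconds z []       = []
  pairs-seconds z (y ∷ zs) = refl ∷ pairs-seconds y zs

  length-pairs : ∀ zs → length zs ≤ length (pairs zs) + 1
  length-pairs []           = z≤n
  length-pairs (x ∷ [])     = ≤-refl
  length-pairs (x ∷ y ∷ zs) = s≤s (length-pairs (y ∷ zs))

  pairs∈⁻ : ∀ {y x} zs → (y , x) ∈ pairs zs → ∃ λ Q → ∃ λ R → zs ≡ Q ++ y ∷ x ∷ R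
  pairs∈⁻ (a ∷ b ∷ zs) (here refl) = [] , zs , refl
  pairs∈⁻ (a ∷ b ∷ zs) (there p∈)  = let Q , R , eq = pairs∈⁻ (b ∷ zs) p∈ in a ∷ Q , R , cong (a ∷_) eq

  fixedPairs : Piece → List (ℕ × ℕ)
  fixedPairs (piece s (const c) (const d)) = pairs (interval s c d)
  fixedPairs _ = []

  data FixedOrNot : Piece → Set where
    static : ∀ {s c d} → FixedOrNot (piece s (const c) (const d))
    mobile : ∀ {p} → fixedPairs p ≡ [] → constLen p ≡ 0 → FixedOrNot p

  fixedOrNot : ∀ p → FixedOrNot p
  fixedOrNot (piece _ (const _) (const _)) = static
  fixedOrNot (piece _ (const _) (left _))  = mobile refl refl
  fixedOrNot (piece _ (const _) (right _)) = mobile refl refl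
  fixedOrNot (piece _ (left _) _)          = mobile refl refl
  fixedOrNot (piece _ (right _) _)         = mobile refl refl

  length-interval : ∀ s l u → length (interval s l u) ≡ u ∸ l
  length-interval true  l u = length-from l (u ∸ l)
  length-interval false l u = trans (length-reverse (from l (u ∸ l))) (length-from l (u ∸ l))

  -- Edges inside constant pieces as ordered pairs, in the direction in which every path of the
  -- family traverses them.
  links : List Piece → List (ℕ × ℕ)
  links []      = []
  links (p ∷ S) = fixedPairs p ++ links S

  -- A nonempty constant piece has one consecutive pair fewer than positions, so at most one is lost
  -- per piece.
  links-large : ∀ S → constLength S ≤ length (links S) + length S
  links-large []      = z≤n
  links-large (p ∷ S) = begin
      constLen p + constLength S                             ≤⟨ +-mono-≤ (one p) (links-large S) ⟩
      length (fixedPairs p) + 1 + (length (links S) + length S)       ≡⟨ +-assoc (length (fixedPairs p)) 1 _ ⟩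
      length (fixedPairs p) + suc (length (links S) + length S)       ≡⟨ cong (length (fixedPairs p) +_) (+-suc (length (links S)) (length S)) ⟨
      length (fixedPairs p) + (length (links S) + suc (length S))     ≡⟨ +-assoc (length (fixedPairs p)) _ _ ⟨
      length (fixedPairs p) + length (links S) + suc (length S)       ≡⟨ cong (_+ suc (length S)) (length-++ (fixedPairs p)) ⟨
      length (fixedPairs p ++ links S) + suc (length S)      ∎
    where
    open ≤-Reasoning
    one : ∀ p → constLen p ≤ length (fixedPairs p) + 1
    one p with fixedOrNot p
    ... | static {s} {c} {d} = ≤-trans (≤-reflexive (sym (length-interval s c d))) (length-pairs (interval s c d))
    ... | mobile _ eq = ≤-trans (≤-reflexive eq) z≤n

  links-firsts : ∀ S a b → Sublist (map proj₁ (links S)) (path S a b)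
  links-firsts []      a b = []
  links-firsts (p ∷ S) a b = subst (λ z → Sublist z (path (p ∷ S) a b)) (sym (map-++ proj₁ (fixedPairs p) (links S)))
      (Subₚ.++⁺ (one p) (links-firsts S a b))
    where
    one : ∀ p → Sublist (map proj₁ (fixedPairs p)) (seg p a b)
    one p with fixedOrNot p
    ... | static = pairs-firsts _
    ... | mobile eq _ = subst (λ z → Sublist (map proj₁ z) (seg p a b)) (sym eq) (minimum _)

  links-seconds : ∀ S a b → Sublist (map proj₂ (links S)) (path S a b)
  links-seconds []      a b = []
  links-seconds (p ∷ S) a b = subst (λ z → Sublist z (path (p ∷ S) a b)) (sym (map-++ proj₂ (fixedPairs p) (links S)))
      (Subₚ.++⁺ (one p) (links-seconds S a b))
    where
    seconds : ∀ zs → Sublist (map proj₂ (pairs zs)) zs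
    seconds []       = []
    seconds (z ∷ zs) = skip z (pairs-seconds z zs)
    one : ∀ p → Sublist (map proj₂ (fixedPairs p)) (seg p a b)
    one p with fixedOrNot p
    ... | static = seconds _
    ... | mobile eq _ = subst (λ z → Sublist (map proj₂ z) (seg p a b)) (sym eq) (minimum _)

  links∈⁻ : ∀ {y x} S a b → (y , x) ∈ links S → ∃ λ Q → ∃ λ R → path S a b ≡ Q ++ y ∷ x ∷ R
  links∈⁻ {y} {x} (p ∷ S) a b l∈ with ∈-++⁻ (fixedPairs p) l∈
  ... | inj₂ l∈′ = let Q , R , eq = links∈⁻ S a b l∈′ in
        seg p a b ++ Q , R , trans (cong (seg p a b ++_) eq) (sym (++-assoc (seg p a b) Q _))
  ... | inj₁ l∈′ = let Q , R , eq = one p l∈′ in Q , R ++ path S a b , trans (cong (_++ path S a b) eq) (++-assoc Q _ _)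
    where
    one : ∀ p → (y , x) ∈ fixedPairs p → ∃ λ Q → ∃ λ R → seg p a b ≡ Q ++ y ∷ x ∷ R
    one p l∈ with fixedOrNot p
    ... | static = pairs∈⁻ _ l∈
    ... | mobile eq _ with subst ((y , x) ∈_) eq l∈
    ...   | ()

  module Closing (m : ℕ) (E : ℕ → ℕ → Set) (E? : ∀ x y → Dec (E x y)) (E-sym : ∀ {x y} → E x y → E y x) where

    open Walks E
    open Rotations m E E-sym
    open Steps m E E? E-sym
    open Growth m E E? E-sym

    Cycle : Set
    Cycle = ∃ λ a → ∃ λ b → ∃ λ xs → Spans a b xs × E b a

    -- The values of f outside N and the members of N are disjoint sets of positions below m.
    missing : ∀ (f : ℕ × ℕ → ℕ) ls N → Unique (map f ls) → (∀ {l} → l ∈ ls → f l < m) → Unique N → (∀ {x} → x ∈ N → x < m) →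
      length (filter (λ l → f l ∉? N) ls) + length N ≤ m
    missing f ls N fls! f<m N! N<m = begin
        length (filter out? ls) + length N           ≡⟨ cong (_+ length N) (length-map f (filter out? ls)) ⟨
        length (map f (filter out? ls)) + length N   ≡⟨ length-++ (map f (filter out? ls)) ⟨
        length (map f (filter out? ls) ++ N)         ≤⟨ Unique-⊆⇒length≤ (Uniqueₚ.++⁺ (Unique-resp-Sublist (Subₚ.map⁺ f (filter-Sublist out? ls)) fls!) N! disjoint) in-range ⟩
        length (upTo m)                              ≡⟨ length-upTo m ⟩
        m                                            ∎
      where
      open ≤-Reasoning
      out? : ∀ l → Dec (f l ∉ N)
      out? l = f l ∉? N
      disjoint : ∀ {x} → x ∈ map f (filter out? ls) × x ∈ N → ⊥
      disjoint (x∈ , x∈N) = let l , l∈ , x≡ = ∈-map⁻ f x∈ in proj₂ (∈-filter⁻ out? {xs = ls} l∈) (subst (_∈ N) x≡ x∈N)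
      in-range : ∀ {x} → x ∈ map f (filter out? ls) ++ N → x ∈ upTo m
      in-range x∈ with ∈-++⁻ (map f (filter out? ls)) x∈
      ... | inj₂ x∈N = ∈-upTo⁺ (N<m x∈N)
      ... | inj₁ x∈′ = let l , l∈ , x≡ = ∈-map⁻ f x∈′ in
        ∈-upTo⁺ (subst (_< m) (sym x≡) (f<m (proj₁ (∈-filter⁻ out? {xs = ls} l∈))))

    -- At most m - |N(B)| links start outside N(B), and at most m - |N(A)| end outside N(A). The
    -- hypothesis leaves a link that does neither.
    close : ∀ {A B S} → Family A B S → 0 < length A → 0 < length B →
      m + m < length (links S) + (length (nbrs A) + length (nbrs B)) → Cycle
    close {A} {B} {S} F A≢[] B≢[] big =
      let (y , x) , l∈ = nonempty-∈ {xs = good} good≢[]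
          l∈₁ , x∈ = ∈-filter⁻ (λ l → proj₂ l ∈? nbrs A) {xs = near} l∈
          l∈₀ , y∈ = ∈-filter⁻ (λ l → proj₁ l ∈? nbrs B) {xs = links S} l∈₁
      in cycle l∈₀ y∈ x∈
      where
      open ≤-Reasoning
      a₀ = nonempty-∈ {xs = A} A≢[]
      b₀ = nonempty-∈ {xs = B} B≢[]
      P₀ = path S (proj₁ a₀) (proj₁ b₀)
      P₀↭ : P₀ ↭ upTo m
      P₀↭ = proj₂ (spans F (proj₂ a₀) (proj₂ b₀))
      P₀! : Unique P₀
      P₀! = Unique-↭ (↭-sym P₀↭) (Uniqueₚ.upTo⁺ m)
      in-range : ∀ (f : ℕ × ℕ → ℕ) → Sublist (map f (links S)) P₀ → ∀ {l} → l ∈ links S → f l < m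
      in-range f τ l∈ = ∈-upTo⁻ (∈-resp-↭ P₀↭ (Subₚ.Any-resp-⊆ τ (∈-map⁺ f l∈)))
      nbrs! : ∀ U → Unique (nbrs U)
      nbrs! U = Uniqueₚ.filter⁺ (adjacent? U) (Uniqueₚ.upTo⁺ m)
      near good : List (ℕ × ℕ)
      near = filter (λ l → proj₁ l ∈? nbrs B) (links S)
      good = filter (λ l → proj₂ l ∈? nbrs A) near
      firsts = links-firsts S (proj₁ a₀) (proj₁ b₀)
      seconds = links-seconds S (proj₁ a₀) (proj₁ b₀)
      far far′ : List (ℕ × ℕ)
      far = filter (λ l → proj₁ l ∉? nbrs B) (links S)
      far′ = filter (λ l → proj₂ l ∉? nbrs A) near
      far≤ : length far + length (nbrs B) ≤ m
      far≤ = missing proj₁ (links S) (nbrs B) (Unique-resp-Sublist firsts P₀!) (in-range proj₁ firsts) (nbrs! B) (λ x∈ → proj₂ (proj₂ (nbrs∈⁻ B x∈)))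
      far′≤ : length far′ + length (nbrs A) ≤ m
      far′≤ = missing proj₂ near (nbrs A)
        (Unique-resp-Sublist (Subₚ.map⁺ proj₂ (filter-Sublist (λ l → proj₁ l ∈? nbrs B) (links S))) (Unique-resp-Sublist seconds P₀!))
        (λ l∈ → in-range proj₂ seconds (proj₁ (∈-filter⁻ (λ l → proj₁ l ∈? nbrs B) {xs = links S} l∈))) (nbrs! A) (λ x∈ → proj₂ (proj₂ (nbrs∈⁻ A x∈)))
      good≢[] : 0 < length good
      good≢[] = +-cancelˡ-< (m + m) _ _ (begin-strict
        m + m + 0                                                                      ≡⟨ +-identityʳ (m + m) ⟩
        m + m                                                                          <⟨ big ⟩
        length (links S) + (length (nbrs A) + length (nbrs B))                         ≡⟨ cong (_+ (length (nbrs A) + length (nbrs B))) (trans (length-filter-split (λ l → proj₁ l ∈? nbrs B) (links S)) (cong (_+ length far) (length-filter-split (λ l → proj₂ l ∈? nbrs A) near))) ⟩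
        length good + length far′ + length far + (length (nbrs A) + length (nbrs B))  ≡⟨ regroup (length good) (length far′) (length far) (length (nbrs A)) (length (nbrs B)) ⟩
        length far′ + length (nbrs A) + (length far + length (nbrs B)) + length good   ≤⟨ +-monoˡ-≤ (length good) (+-mono-≤ far′≤ far≤) ⟩
        m + m + length good                                                            ∎)
        where
        regroup : ∀ p q r s t → p + q + r + (s + t) ≡ q + s + (r + t) + p
        regroup = solve-∀
      cycle : ∀ {y x} → (y , x) ∈ links S → y ∈ nbrs B → x ∈ nbrs A → Cycle
      cycle {y} {x} l∈ y∈ x∈ =
        let a∈ , ax , _ = nbrs∈⁻ A x∈
            b∈ , by , _ = nbrs∈⁻ B y∈
            Q , R , eq = links∈⁻ S (pick A x) (pick B y) l∈
            w , perm = spans F a∈ b∈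
            w₁ , _ , w₂ = walk-split Q (subst (λ z → Walk (pick A x) z (pick B y)) eq w)
        -- The path a ... y x ... b turns into a ... y b ... x, and x is adjacent to a.
        in pick A x , x , (Q ++ y ∷ []) ++ reverse (x ∷ R) ,
           (walk-++ w₁ (E-sym by) (walk-reverse E-sym w₂) ,
            ↭-trans (++⁺ˡ (Q ++ y ∷ []) (↭-reverse (x ∷ R))) (↭-trans (↭-reflexive (trans (++-assoc Q (y ∷ []) (x ∷ R)) (sym eq))) perm)) ,
           E-sym ax

    -- The cap at m shortens or empties the last pieces when k * ℓ exceeds m.
    chop : ℕ → ℕ → ℕ → List Piece
    chop ℓ i zero    = []
    chop ℓ i (suc k) = piece true (const (i * ℓ ⊓ m)) (const (suc i * ℓ ⊓ m)) ∷ chop ℓ (suc i) k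

    end-mono : ∀ ℓ i j → i ≤ j → i * ℓ ⊓ m ≤ j * ℓ ⊓ m
    end-mono ℓ i j i≤j = ⊓-monoˡ-≤ m (*-monoˡ-≤ ℓ i≤j)

    split-difference : ∀ {x y z} → x ≤ y → y ≤ z → z ∸ x ≡ (y ∸ x) + (z ∸ y)
    split-difference {x} {y} {z} x≤y y≤z = trans (cong (_∸ x) (sym (m+[n∸m]≡n y≤z))) (+-∸-comm (z ∸ y) x≤y)

    path-chop : ∀ ℓ i k a b → path (chop ℓ i k) a b ≡ from (i * ℓ ⊓ m) ((i + k) * ℓ ⊓ m ∸ i * ℓ ⊓ m)
    path-chop ℓ i zero    a b rewrite +-identityʳ i | n∸n≡0 (i * ℓ ⊓ m) = refl
    path-chop ℓ i (suc k) a b = trans (cong (from x (y ∸ x) ++_) (trans (path-chop ℓ (suc i) k a b) (cong (λ j → from y (j * ℓ ⊓ m ∸ y)) (sym (+-suc i k)))))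
        (sym (trans (cong (from x) (split-difference x≤y y≤z)) (trans (from-++ x (y ∸ x) (z ∸ y)) (cong (λ v → from x (y ∸ x) ++ from v (z ∸ y)) (m+[n∸m]≡n x≤y)))))
      where
      x = i * ℓ ⊓ m
      y = suc i * ℓ ⊓ m
      z = (i + suc k) * ℓ ⊓ m
      x≤y : x ≤ y
      x≤y = end-mono ℓ i (suc i) (n≤1+n i)
      y≤z : y ≤ z
      y≤z = end-mono ℓ (suc i) (i + suc k) (≤-trans (s≤s (m≤m+n i k)) (≤-reflexive (sym (+-suc i k))))

    constLength-chop : ∀ ℓ i k a b → constLength (chop ℓ i k) ≡ length (path (chop ℓ i k) a b)
    constLength-chop ℓ i zero    a b = refl
    constLength-chop ℓ i (suc k) a b = sym (trans (length-++ (from (i * ℓ ⊓ m) d)) (cong₂ _+_ (length-from (i * ℓ ⊓ m) d) (sym (constLength-chop ℓ (suc i) k a b))))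
      where
      d = suc i * ℓ ⊓ m ∸ i * ℓ ⊓ m

    length-chop : ∀ ℓ i k → length (chop ℓ i k) ≡ k
    length-chop ℓ i zero    = refl
    length-chop ℓ i (suc k) = cong suc (length-chop ℓ (suc i) k)

    chop-short : ∀ ℓ i k → All (Short ℓ) (chop ℓ i k)
    chop-short ℓ i zero    = []
    chop-short ℓ i (suc k) = m≤n+o⇒m∸n≤o _ (i * ℓ ⊓ m) (≤-trans (⊓-monoʳ-≤ (suc i * ℓ) (m≤n+m m ℓ)) (≤-reflexive (trans (sym (+-distribˡ-⊓ ℓ (i * ℓ) m)) (+-comm ℓ _)))) ∷ chop-short ℓ (suc i) k

    walk-from : ∀ l k → (∀ i → suc i ≤ l + k → E i (suc i)) → Walk l (from l (suc k)) (l + k)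
    walk-from l zero    e = subst (Walk l (l ∷ [])) (sym (+-identityʳ l)) nil
    walk-from l (suc k) e = cons (e l (m≤m+n (suc l) k ▹ sym (+-suc l k)))
      (subst (Walk (suc l) (from (suc l) (suc k))) (sym (+-suc l k)) (walk-from (suc l) k (λ i i< → e i (i< ▹ sym (+-suc l k)))))
      where
      _▹_ : ∀ {x y z : ℕ} → x ≤ y → y ≡ z → x ≤ z
      p ▹ refl = p

    start : ∀ k ℓ → 0 < m → m ≤ k * ℓ → (∀ i → suc i < m → E i (suc i)) →
      Family (0 ∷ []) ((m ∸ 1) ∷ []) (chop ℓ 0 k) × Shape m k ℓ 0 (chop ℓ 0 k)
    start k ℓ 0<m m≤kℓ e = record
        { A! = [] ∷ [] ; B! = [] ∷ []
        ; spans = λ { (here refl) (here refl) → subst (λ z → Walk 0 z (m ∸ 1)) (sym (whole 0 (m ∸ 1))) (base 0<m e) ,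
                        ↭-reflexive (trans (whole 0 (m ∸ 1)) (from≡upTo m)) }
        } , record
        { pieces = ≤-reflexive (trans (length-chop ℓ 0 k) (sym (+-identityʳ k)))
        ; fixed = ≤-reflexive (sym (trans (+-identityʳ _) (trans (constLength-chop ℓ 0 k 0 0) (trans (cong length (whole 0 0)) (length-from 0 m)))))
        ; short = chop-short ℓ 0 k
        }
      where
      whole : ∀ a b → path (chop ℓ 0 k) a b ≡ from 0 m
      whole a b = trans (path-chop ℓ 0 k a b) (cong (from 0) (m≥n⇒m⊓n≡n m≤kℓ))
      base : ∀ {m} → 0 < m → (∀ i → suc i < m → E i (suc i)) → Walk 0 (from 0 m) (m ∸ 1)
      base {suc m} _ e = walk-from 0 m (λ i i< → e i (s≤s i<))

    module _ (n k ℓ R T D M g L q : ℕ) (0<m : 0 < m) (m≤n : m ≤ n) (m≤kℓ : m ≤ k * ℓ) (0<g : 0 < g) (0<T : 0 < T)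
      (D-large : loss (k + 2 * suc R) * g ≤ D) (TM≤n : T * M ≤ n) (T≤gᴿ : T ≤ g ^ R)
      (gT-large : n ≤ g * T * L) (few : q * (k + 2 * suc R + 2 * suc R * ℓ) < n)
      (base : ∀ i → suc i < m → E i (suc i))
      (expands : ∀ U → Unique U → (∀ {u} → u ∈ U → EndPoint u) → length U * M ≤ n → length U * D ≤ 15 * length (nbrs U))
      (expands-half : ∀ U → Unique U → (∀ {u} → u ∈ U → EndPoint u) → n ≤ length U * L → suc q * n ≤ 2 * q * length (nbrs U))
      where

      cycle-from-expansion : Cycle
      cycle-from-expansion = finish (final-round n k ℓ (k + 2 * suc R) D M g 0<K 0<g D-large expands T R 0<T TM≤n T≤gᴿ ≤-refl
          (large (proj₁ st) (proj₂ st) ≤-refl ≤-refl))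
        where
        0<K : 0 < k + 2 * suc R
        0<K = ≤-trans (s≤s z≤n) (m≤n+m (2 * suc R) k)
        st = start k ℓ 0<m m≤kℓ base
        finish : Large n k ℓ (k + 2 * suc R) D M g 0<K 0<g D-large expands (g * T) (2 * suc R) → Cycle
        -- Divided by q: |N(A)| + |N(B)| is at least (1 + 1/q)n, and the links fall short of m by
        -- less than n/q, so the total exceeds m + n, which is at least 2m.
        finish (large {A} {B} {S} F sh A≥ B≥) = close F A≢[] B≢[]
            (*-cancelˡ-< q (m + m) (c + (NA + NB)) (begin-strict
              q * (m + m)                                       ≡⟨ *-distribˡ-+ q m m ⟩
              q * m + q * m                                     ≤⟨ +-mono-≤ (*-monoʳ-≤ q m≤n) (*-monoʳ-≤ q m≤) ⟩
              q * n + q * (c + e)                               ≡⟨ cong (q * n +_) (*-distribˡ-+ q c e) ⟩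
              q * n + (q * c + q * e)                           <⟨ +-monoʳ-< (q * n) (+-monoʳ-< (q * c) few) ⟩
              q * n + (q * c + n)                               ≡⟨ regroup (q * n) (q * c) n ⟩
              q * c + suc q * n                                 ≤⟨ +-monoʳ-≤ (q * c) halves ⟩
              q * c + q * (NA + NB)                             ≡⟨ *-distribˡ-+ q c (NA + NB) ⟨
              q * (c + (NA + NB))                               ∎))
          where
          open ≤-Reasoning
          c = length (links S)
          e = k + 2 * suc R + 2 * suc R * ℓ
          NA = length (nbrs A)
          NB = length (nbrs B)
          0<gT : 0 < g * T
          0<gT = *-mono-≤ 0<g 0<T
          A≢[] : 0 < length A
          A≢[] = <-≤-trans 0<gT A≥
          B≢[] : 0 < length B
          B≢[] = <-≤-trans 0<gT B≥
          m≤ : m ≤ c + e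
          m≤ = begin
            m                                               ≤⟨ Shape.fixed sh ⟩
            constLength S + 2 * suc R * ℓ                   ≤⟨ +-monoˡ-≤ (2 * suc R * ℓ) (≤-trans (links-large S) (+-monoʳ-≤ c (pieces sh))) ⟩
            c + (k + 2 * suc R) + 2 * suc R * ℓ             ≡⟨ +-assoc c (k + 2 * suc R) _ ⟩
            c + e                                           ∎
          regroup : ∀ x y z → x + (y + z) ≡ y + (z + x)
          regroup = solve-∀
          halves : suc q * n ≤ q * (NA + NB)
          halves = *-cancelˡ-≤ 2 (begin
            2 * (suc q * n)                     ≡⟨ cong (suc q * n +_) (+-identityʳ (suc q * n)) ⟩
            suc q * n + suc q * n               ≤⟨ +-mono-≤
              (expands-half A (A! F) (endPoints F B≢[]) (≤-trans gT-large (*-monoˡ-≤ L A≥)))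
              (expands-half B (B! F) (endPoints (mirror-family F) A≢[]) (≤-trans gT-large (*-monoˡ-≤ L B≥))) ⟩
            2 * q * NA + 2 * q * NB             ≡⟨ *-distribˡ-+ (2 * q) NA NB ⟨
            2 * q * (NA + NB)                   ≡⟨ *-assoc 2 q (NA + NB) ⟩
            2 * (q * (NA + NB))                 ∎)

-- Parameters in terms of an integer logarithm to the base 4.

module ParameterChoice where

  open Prelude
  open EndpointGrowth using (loss)
  open import Data.Nat.Tactic.RingSolver using (solve-∀)

  -- With h the half of L rounded down, 4L ≤ 2 ^ h suffices. The bound 4(2h + 1) ≤ 2 ^ h holds from
  -- h = 6 on, which explains the 12.
  exponential-large : ∀ L → 12 ≤ L → (4 * L) ^ 4 ≤ 4 ^ L
  exponential-large L 12≤L = begin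
      (4 * L) ^ 4              ≤⟨ ^-monoˡ-≤ 4 4L≤ ⟩
      (2 ^ h) ^ 4              ≡⟨ ^-*-assoc 2 h 4 ⟩
      2 ^ (h * 4)              ≡⟨ cong (2 ^_) (trans (cong (h *_) {4} {2 * 2} refl) (trans (sym (*-assoc h 2 2)) (*-comm (h * 2) 2))) ⟩
      2 ^ (2 * (h * 2))        ≡⟨ ^-*-assoc 2 2 (h * 2) ⟨
      4 ^ (h * 2)              ≤⟨ ^-monoʳ-≤ 4 (m/n*n≤m L 2) ⟩
      4 ^ L                    ∎
    where
    open ≤-Reasoning
    h = L / 2
    grow : ∀ j → 4 * suc (2 * (6 + j)) ≤ 2 ^ (6 + j)
    grow zero    = m≤m+n 52 12
    grow (suc j) = begin
      4 * suc (2 * (7 + j))          ≡⟨ shift j ⟩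
      4 * suc (2 * (6 + j)) + 8      ≤⟨ +-mono-≤ (grow j) (≤-trans (m≤m*n 8 (2 ^ j) {{m^n≢0 2 j}}) (≤-trans (*-monoˡ-≤ (2 ^ j) (m≤m+n 8 56)) (≤-reflexive (sym (^-distribˡ-+-* 2 6 j))))) ⟩
      2 ^ (6 + j) + 2 ^ (6 + j)      ≡⟨ cong (2 ^ (6 + j) +_) (+-identityʳ (2 ^ (6 + j))) ⟨
      2 ^ (7 + j)                    ∎
      where
      shift : ∀ j → 4 * suc (2 * (7 + j)) ≡ 4 * suc (2 * (6 + j)) + 8
      shift = solve-∀
    6≤h : 6 ≤ h
    6≤h = /-monoˡ-≤ 2 12≤L
    4L≤ : 4 * L ≤ 2 ^ h
    4L≤ = begin
      4 * L                  ≤⟨ *-monoʳ-≤ 4 (≤-trans (≤-reflexive (m≡m%n+[m/n]*n L 2)) (+-mono-≤ (≤-pred (m%n<n L 2)) (≤-reflexive (*-comm h 2)))) ⟩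
      4 * suc (2 * h)        ≤⟨ subst (λ z → 4 * suc (2 * z) ≤ 2 ^ z) (m+[n∸m]≡n 6≤h) (grow (h ∸ 6)) ⟩
      2 ^ h                  ∎

  -- With L the logarithm of n to the base 4, L ^ i and (2 * suc L) ^ i bound the i-th power of log n from below and above.
  record Parameters (q L n : ℕ) : Set where
    field
      k ℓ R T g : ℕ
      n≤kℓ : n ≤ k * ℓ
      0<g : 0 < g
      0<T : 0 < T
      D-large : loss (k + 2 * suc R) * g ≤ L ^ 4
      TM≤n : T * (2 * suc L) ^ 4 ≤ n
      T≤gᴿ : T ≤ g ^ R
      gT-large : n ≤ g * T * L ^ 3
      few : q * (k + 2 * suc R + 2 * suc R * ℓ) < n

  module Choice (q : ℕ) (0<q : 0 < q) where

    -- For r rounds there are 8qr initial pieces and 2r rotations, so K = ur. C = 128u turns Cr ≤ L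
    -- into 128K ≤ L, and 128³ exceeds 15 · 64 · 512, the constants of `loss` and g. The 3 in ω
    -- serves R + 2 ≤ 3R.
    u C ω : ℕ
    u = 8 * q + 2
    C = 8 * (8 * (2 * u))
    ω = 3 * C

    -- The summands secure, in turn, 4 ^ ω ≤ L for enough growth per round, at least two rounds, and
    -- `exponential-large`.
    threshold : ℕ
    threshold = 4 ^ ω + 2 * C + 12

    module Fixed (L n R : ℕ) (12≤L : 12 ≤ L) (4^ω≤L : 4 ^ ω ≤ L) (4^L≤n : 4 ^ L ≤ n) (n< : n < 4 ^ suc L)
      (0<R : 0 < R) (CR≤L : suc R * C ≤ L) (L<CR : L < suc (suc R) * C) where

      open ≤-Reasoning
      r k K g M T : ℕ
      r = suc R
      -- The 2r rotations spoil at most 2r of the k pieces, about n / (4q) positions, a quarter of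
      -- the slack n/q.
      k = 8 * q * r
      K = k + 2 * r
      -- The factor is 512 = 2 · 4⁴: from n ≤ 2TM and M ≤ (4L)⁴ it follows that g * T is at least n
      -- / L³.
      g = 8 * (8 * (8 * L))
      M = (2 * suc L) ^ 4

      instance
        q≢0 : NonZero q
        q≢0 = >-nonZero 0<q
        k≢0 : NonZero k
        k≢0 = m*n≢0 (8 * q) r {{m*n≢0 8 q}}
        L≢0 : NonZero L
        L≢0 = >-nonZero (≤-trans (s≤s z≤n) 12≤L)
        M≢0 : NonZero M
        M≢0 = m^n≢0 (2 * suc L) 4

      T = n / M

      K≡ : K ≡ u * r
      K≡ = sym (*-distribʳ-+ r (8 * q) 2)

      128K≤L : 8 * (8 * (2 * K)) ≤ L
      128K≤L = ≤-trans (≤-reflexive (trans (cong (λ z → 8 * (8 * (2 * z))) K≡) (regroup 8 2 u r))) CR≤L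
        where
        regroup : ∀ e f u r → e * (e * (f * (u * r))) ≡ r * (e * (e * (f * u)))
        regroup = solve-∀

      M≤4L : M ≤ (4 * L) ^ 4
      M≤4L = ^-monoˡ-≤ 4 (≤-trans (*-monoʳ-≤ 2 (+-monoˡ-≤ L (≤-trans (s≤s z≤n) 12≤L))) (≤-reflexive (double L)))
        where
        double : ∀ L → 2 * (L + L) ≡ 4 * L
        double = solve-∀

      4L≤n : (4 * L) ^ 4 ≤ n
      4L≤n = ≤-trans (exponential-large L 12≤L) 4^L≤n

      1≤T : 1 ≤ T
      1≤T = m≥n⇒m/n>0 (≤-trans M≤4L 4L≤n)

      D-large : loss K * g ≤ L ^ 4
      D-large = begin
        15 * (8 * K * (8 * K * K)) * g              ≤⟨ *-monoˡ-≤ g (*-monoˡ-≤ (8 * K * (8 * K * K)) (m≤m+n 15 1)) ⟩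
        2 * 8 * (8 * K * (8 * K * K)) * g           ≤⟨ m≤m*n (2 * 8 * (8 * K * (8 * K * K)) * g) 4 ⟩
        2 * 8 * (8 * K * (8 * K * K)) * g * 4       ≡⟨ regroup 8 K L ⟩
        P * (P * (P * L))                           ≤⟨ *-mono-≤ 128K≤L (*-mono-≤ 128K≤L (*-monoˡ-≤ L 128K≤L)) ⟩
        L * (L * (L * L))                           ≡⟨ cong (λ z → L * (L * (L * z))) (*-identityʳ L) ⟨
        L ^ 4                                       ∎
        where
        P = 8 * (8 * (2 * K))
        regroup : ∀ e K L → 2 * e * (e * K * (e * K * K)) * (e * (e * (e * L))) * 4
          ≡ e * (e * (2 * K)) * (e * (e * (2 * K)) * (e * (e * (2 * K)) * L))
        regroup = solve-∀

      gT-large : n ≤ g * T * L ^ 3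
      gT-large = begin
        n                                  ≡⟨ m≡m%n+[m/n]*n n M ⟩
        n % M + T * M                      ≤⟨ +-monoˡ-≤ (T * M) (<⇒≤ (m%n<n n M)) ⟩
        M + T * M                          ≤⟨ +-monoˡ-≤ (T * M) (m≤n*m M T {{>-nonZero 1≤T}}) ⟩
        T * M + T * M                      ≡⟨ cong (T * M +_) (+-identityʳ (T * M)) ⟨
        2 * (T * M)                        ≤⟨ *-monoʳ-≤ 2 (*-monoʳ-≤ T M≤4L) ⟩
        2 * (T * (2 * 2 * L) ^ 4)          ≡⟨ regroup 2 T L ⟩
        g * T * L ^ 3                      ∎
        where
        regroup : ∀ e T L → e * (T * (e * e * L * (e * e * L * (e * e * L * (e * e * L * 1)))))
          ≡ e * e * e * (e * e * e * (e * e * e * L)) * T * (L * (L * (L * 1)))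
        regroup = solve-∀

      -- The crude bound T ≤ n < 4 ^ (L + 1) is enough, as g ≥ L ≥ 4 ^ ω and ωR ≥ L + 1.
      T≤gᴿ : T ≤ g ^ R
      T≤gᴿ = begin
        T                ≤⟨ m/n≤m n M ⟩
        n                ≤⟨ <⇒≤ n< ⟩
        4 ^ suc L        ≤⟨ ^-monoʳ-≤ 4 L≤ωR ⟩
        4 ^ (ω * R)      ≡⟨ ^-*-assoc 4 ω R ⟨
        (4 ^ ω) ^ R      ≤⟨ ^-monoˡ-≤ R (≤-trans 4^ω≤L (≤-trans (m≤n*m L 8) (≤-trans (m≤n*m (8 * L) 8) (m≤n*m (8 * (8 * L)) 8)))) ⟩
        g ^ R            ∎
        where
        L≤ωR : suc L ≤ ω * R
        L≤ωR = begin
          suc L                ≤⟨ L<CR ⟩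
          suc (suc R) * C      ≤⟨ *-monoˡ-≤ C (+-monoˡ-≤ R (+-mono-≤ 0<R 0<R)) ⟩
          (R + R + R) * C      ≡⟨ regroup R C ⟩
          ω * R                ∎
          where
          regroup : ∀ R C → (R + R + R) * C ≡ 3 * C * R
          regroup = solve-∀

      ℓ : ℕ
      ℓ = suc (n / k)

      n≤kℓ : n ≤ k * ℓ
      n≤kℓ = begin
        n                       ≡⟨ m≡m%n+[m/n]*n n k ⟩
        n % k + n / k * k       ≤⟨ +-monoˡ-≤ (n / k * k) (<⇒≤ (m%n<n n k)) ⟩
        ℓ * k                   ≡⟨ *-comm ℓ k ⟩
        k * ℓ                   ∎

      few : q * (K + 2 * r * ℓ) < n
      few = *-cancelˡ-< 4 _ n (begin-strict
        4 * (q * (K + 2 * r * ℓ))                       ≡⟨ expand q K r (n / k) ⟩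
        4 * q * K + 4 * q * (2 * r) + n / k * k         ≤⟨ +-mono-≤ (+-monoʳ-≤ (4 * q * K) (*-monoʳ-≤ (4 * q) (m≤n+m (2 * r) k))) (m/n*n≤m n k) ⟩
        4 * q * K + 4 * q * K + n                       ≡⟨ cong (_+ n) (fold q K) ⟩
        8 * q * K + n                                   ≤⟨ +-monoˡ-≤ n (≤-trans 8qK≤ 4L≤n) ⟩
        n + n                                           <⟨ m<m+n (n + n) (+-mono-< 0<n 0<n) ⟩
        n + n + (n + n)                                 ≡⟨ four n ⟩
        4 * n                                           ∎)
        where
        0<n : 0 < n
        0<n = ≤-trans (m^n>0 4 L) 4^L≤n
        expand : ∀ q K r x → 4 * (q * (K + 2 * r * suc x)) ≡ 4 * q * K + 4 * q * (2 * r) + x * (8 * q * r)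
        expand = solve-∀
        fold : ∀ q K → 4 * q * K + 4 * q * K ≡ 8 * q * K
        fold = solve-∀
        four : ∀ n → n + n + (n + n) ≡ 4 * n
        four = solve-∀
        8q≤K : 8 * q ≤ K
        8q≤K = ≤-trans (m≤m*n (8 * q) r) (m≤m+n k (2 * r))
        K≤L : K ≤ L
        K≤L = ≤-trans (≤-trans (m≤n*m K 2) (≤-trans (m≤n*m (2 * K) 8) (m≤n*m (8 * (2 * K)) 8))) 128K≤L
        K≤4L : K ≤ 4 * L
        K≤4L = ≤-trans K≤L (m≤n*m L 4)
        8qK≤ : 8 * q * K ≤ (4 * L) ^ 4
        8qK≤ = begin
          8 * q * K                 ≤⟨ *-mono-≤ (≤-trans 8q≤K K≤4L) (≤-trans K≤4L (m≤m*n (4 * L) ((4 * L) ^ 2) {{m^n≢0 (4 * L) 2 {{m*n≢0 4 L}}}})) ⟩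
          (4 * L) ^ 4               ∎

      parameters : Parameters q L n
      parameters = record
        { k = k ; ℓ = ℓ ; R = R ; T = T ; g = g ; n≤kℓ = n≤kℓ
        ; 0<g = *-mono-≤ {1} {8} (s≤s z≤n) (*-mono-≤ {1} {8} (s≤s z≤n) (*-mono-≤ {1} {8} (s≤s z≤n) (≤-trans (s≤s z≤n) 12≤L)))
        ; 0<T = 1≤T ; D-large = D-large ; TM≤n = m/n*n≤m n M ; T≤gᴿ = T≤gᴿ ; gT-large = gT-large ; few = few }

    parameters-exist : ∀ L n → threshold ≤ L → 4 ^ L ≤ n → n < 4 ^ suc L → Parameters q L n
    parameters-exist L n thr 4^L≤n n< = build (L / C) 2≤r (m/n*n≤m L C)
        (subst (_< suc (L / C) * C) (sym (m≡m%n+[m/n]*n L C)) (+-monoˡ-< (L / C * C) (m%n<n L C)))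
      where
      instance
        C≢0 : NonZero C
        C≢0 = m*n≢0 8 (8 * (2 * u)) {{_}} {{m*n≢0 8 (2 * u) {{_}} {{m*n≢0 2 u {{_}} {{>-nonZero (≤-trans (s≤s z≤n) (m≤n+m 2 (8 * q)))}}}}}}
      2C≤L : 2 * C ≤ L
      2C≤L = ≤-trans (≤-trans (m≤n+m (2 * C) (4 ^ ω)) (m≤m+n (4 ^ ω + 2 * C) 12)) thr
      2≤r : 2 ≤ L / C
      2≤r = ≤-trans (≤-reflexive (sym (m*n/n≡m 2 C))) (/-monoˡ-≤ C 2C≤L)
      build : ∀ r → 2 ≤ r → r * C ≤ L → L < suc r * C → Parameters q L n
      build (suc R) (s≤s 0<R) rC≤L L<rC = Fixed.parameters L n R (≤-trans (m≤n+m 12 (4 ^ ω + 2 * C)) thr)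
        (≤-trans (≤-trans (m≤m+n (4 ^ ω) (2 * C)) (m≤m+n (4 ^ ω + 2 * C) 12)) thr) 4^L≤n n< 0<R rC≤L L<rC

  log₄ : ∀ n → 0 < n → ∃ λ L → 4 ^ L ≤ n × n < 4 ^ suc L
  log₄ (suc zero)      _ = 0 , ≤-refl , s≤s (s≤s z≤n)
  log₄ (suc n@(suc _)) _ with log₄ n z<s
  ... | L , lower , upper with suc n <? 4 ^ suc L
  ...   | yes p = L , m≤n⇒m≤1+n lower , p
  ...   | no ¬p = suc L , ≮⇒≥ ¬p , ≤-<-trans upper (^-monoʳ-< 4 (s≤s (s≤s z≤n)) (n<1+n (suc L)))

  4^-cancel-≤ : ∀ {a L n} → 4 ^ a ≤ n → n < 4 ^ suc L → a ≤ L
  4^-cancel-≤ {a} {L} 4^a≤n n< = ≮⇒≥ λ L<a → <⇒≱ n< (≤-trans (^-monoʳ-≤ 4 L<a) 4^a≤n)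

-- The exponential series between powers of 2 and of 4, and the encoded logarithm.

module LogarithmBounds where

  open import Data.Nat as ℕ using (ℕ; zero; suc)
  import Data.Nat.Properties as ℕₚ
  import Data.Integer as ℤ
  import Data.Integer.Properties as ℤₚ
  open import Data.Integer using (+_)
  import Data.Nat.Coprimality as Coprime
  open import Data.Rational
  open import Data.Rational.Properties
  open import Data.Rational.Solver using (module +-*-Solver)
  open import Data.Product using (∃; _×_; _,_)
  open import Data.Sum using (inj₁; inj₂)
  open import Data.Empty using (⊥; ⊥-elim)
  open import Relation.Binary.PropositionalEquality
  open import Defs using (ℕtoℚ; powℚ; expTerm; expPartial; MulLogPowLe; LeMulLogPow)
  open +-*-Solver

  <⇒≱ : ∀ {p q} → p < q → q ≤ p → ⊥
  <⇒≱ p<q q≤p = <-irrefl refl (<-≤-trans p<q q≤p)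

  recip : ℕ → ℚ
  recip d = + 1 / suc d

  ℕtoℚ≡mkℚ : ∀ k → ℕtoℚ k ≡ mkℚ (+ k) 0 (Coprime.sym (Coprime.1-coprimeTo k))
  ℕtoℚ≡mkℚ k = normalize-coprime (Coprime.sym (Coprime.1-coprimeTo k))

  recip≡mkℚ : ∀ d → recip d ≡ mkℚ (+ 1) d (Coprime.1-coprimeTo (suc d))
  recip≡mkℚ d = normalize-coprime (Coprime.1-coprimeTo (suc d))

  ℕtoℚ-mono-≤ : ∀ {a b} → a ℕ.≤ b → ℕtoℚ a ≤ ℕtoℚ b
  ℕtoℚ-mono-≤ {a} {b} a≤b rewrite ℕtoℚ≡mkℚ a | ℕtoℚ≡mkℚ b =
    *≤* (subst₂ ℤ._≤_ (sym (ℤₚ.*-identityʳ (+ a))) (sym (ℤₚ.*-identityʳ (+ b))) (ℤ.+≤+ a≤b))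

  ℕtoℚ-cancel-≤ : ∀ {a b} → ℕtoℚ a ≤ ℕtoℚ b → a ℕ.≤ b
  ℕtoℚ-cancel-≤ {a} {b} p rewrite ℕtoℚ≡mkℚ a | ℕtoℚ≡mkℚ b =
    ℤₚ.drop‿+≤+ (subst₂ ℤ._≤_ (ℤₚ.*-identityʳ (+ a)) (ℤₚ.*-identityʳ (+ b)) (drop-*≤* p))

  ℕtoℚ-mono-< : ∀ {a b} → a ℕ.< b → ℕtoℚ a < ℕtoℚ b
  ℕtoℚ-mono-< {a} {b} a<b = ≰⇒> λ b≤a → ℕₚ.<⇒≱ a<b (ℕtoℚ-cancel-≤ b≤a)

  ℕtoℚ-+ : ∀ a b → ℕtoℚ (a ℕ.+ b) ≡ ℕtoℚ a + ℕtoℚ b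
  ℕtoℚ-+ a b rewrite ℕtoℚ≡mkℚ a | ℕtoℚ≡mkℚ b =
    sym (/-cong {q₁ = 1} {q₂ = 1} (cong₂ ℤ._+_ (ℤₚ.*-identityʳ (+ a)) (ℤₚ.*-identityʳ (+ b))) refl)

  ℕtoℚ-* : ∀ a b → ℕtoℚ (a ℕ.* b) ≡ ℕtoℚ a * ℕtoℚ b
  ℕtoℚ-* a b rewrite ℕtoℚ≡mkℚ a | ℕtoℚ≡mkℚ b = /-cong {q₁ = 1} {q₂ = 1} (ℤₚ.pos-* a b) refl

  ℕtoℚ-suc : ∀ a → ℕtoℚ (suc a) ≡ 1ℚ + ℕtoℚ a
  ℕtoℚ-suc a = ℕtoℚ-+ 1 a

  recip-inverse : ∀ d → recip d * ℕtoℚ (suc d) ≡ 1ℚ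
  recip-inverse d rewrite recip≡mkℚ d | ℕtoℚ≡mkℚ (suc d) = *-inverseʳ (mkℚ (+ 1) d (Coprime.1-coprimeTo (suc d)))

  ℕtoℚ-^ : ∀ a k → powℚ (ℕtoℚ a) k ≡ ℕtoℚ (a ℕ.^ k)
  ℕtoℚ-^ a zero    = refl
  ℕtoℚ-^ a (suc k) = trans (cong (ℕtoℚ a *_) (ℕtoℚ-^ a k)) (sym (ℕtoℚ-* a (a ℕ.^ k)))

  0≤ℕtoℚ : ∀ k → 0ℚ ≤ ℕtoℚ k
  0≤ℕtoℚ k = ℕtoℚ-mono-≤ {0} {k} ℕ.z≤n

  *-monoʳ : ∀ {r p q} → 0ℚ ≤ r → p ≤ q → r * p ≤ r * q
  *-monoʳ {r} 0≤r p≤q = *-monoˡ-≤-nonNeg r {{nonNegative 0≤r}} p≤q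

  *-mono : ∀ {p q r s} → 0ℚ ≤ p → 0ℚ ≤ s → p ≤ q → r ≤ s → p * r ≤ q * s
  *-mono {p} {q} {r} {s} 0≤p 0≤s p≤q r≤s = ≤-trans (*-monoʳ 0≤p r≤s) (*-monoʳ-≤-nonNeg s {{nonNegative 0≤s}} p≤q)

  0≤* : ∀ {p q} → 0ℚ ≤ p → 0ℚ ≤ q → 0ℚ ≤ p * q
  0≤* {p} {q} 0≤p 0≤q = subst (_≤ p * q) (*-zeroʳ p) (*-monoʳ 0≤p 0≤q)

  0≤+ : ∀ {p q} → 0ℚ ≤ p → 0ℚ ≤ q → 0ℚ ≤ p + q
  0≤+ {p} {q} 0≤p 0≤q = subst (_≤ p + q) (+-identityˡ 0ℚ) (+-mono-≤ 0≤p 0≤q)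

  0≤recip : ∀ d → 0ℚ ≤ recip d
  0≤recip d = nonNegative⁻¹ (recip d) {{normalize-nonNeg 1 (suc d)}}

  0≤1 : 0ℚ ≤ 1ℚ
  0≤1 = 0≤ℕtoℚ 1

  powℚ-mono : ∀ {s t} k → 0ℚ ≤ s → s ≤ t → 0ℚ ≤ powℚ s k × powℚ s k ≤ powℚ t k
  powℚ-mono zero    0≤s s≤t = 0≤1 , ≤-refl
  powℚ-mono (suc k) 0≤s s≤t with powℚ-mono k 0≤s s≤t
  ... | 0≤ , p≤ = 0≤* 0≤s 0≤ , *-mono 0≤s (≤-trans 0≤ p≤) s≤t p≤

  expTerm-mono : ∀ {s t} j → 0ℚ ≤ s → s ≤ t → 0ℚ ≤ expTerm s j × expTerm s j ≤ expTerm t j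
  expTerm-mono zero    0≤s s≤t = 0≤1 , ≤-refl
  expTerm-mono (suc j) 0≤s s≤t with expTerm-mono j 0≤s s≤t
  ... | 0≤ , e≤ = 0≤* (0≤* 0≤ 0≤s) (0≤recip j) ,
    *-monoʳ-≤-nonNeg (recip j) {{nonNegative (0≤recip j)}} (*-mono 0≤ (≤-trans 0≤s s≤t) e≤ s≤t)

  0≤expTerm : ∀ {t} j → 0ℚ ≤ t → 0ℚ ≤ expTerm t j
  0≤expTerm j 0≤t with expTerm-mono j 0≤t ≤-refl
  ... | 0≤ , _ = 0≤

  expPartial-mono : ∀ {s t} N → 0ℚ ≤ s → s ≤ t → expPartial s N ≤ expPartial t N
  expPartial-mono zero    _   _   = ≤-refl
  expPartial-mono (suc N) 0≤s s≤t with expTerm-mono N 0≤s s≤t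
  ... | _ , e≤ = +-mono-≤ (expPartial-mono N 0≤s s≤t) e≤

  expPartial-suc : ∀ {t} N → 0ℚ ≤ t → expPartial t N ≤ expPartial t (suc N)
  expPartial-suc {t} N 0≤t = subst (_≤ expPartial t (suc N)) (+-identityʳ (expPartial t N)) (+-monoʳ-≤ (expPartial t N) (0≤expTerm N 0≤t))

  expTerm-suc : ∀ t j → expTerm t (suc j) * ℕtoℚ (suc j) ≡ expTerm t j * t
  expTerm-suc t j = trans (*-assoc (expTerm t j * t) (recip j) (ℕtoℚ (suc j)))
    (trans (cong (expTerm t j * t *_) (recip-inverse j)) (*-identityʳ _))

  cancel-suc : ∀ {p q} j → p * ℕtoℚ (suc j) ≤ q * ℕtoℚ (suc j) → p ≤ q
  cancel-suc j = *-cancelʳ-≤-pos (ℕtoℚ (suc j)) {{normalize-pos (suc j) 1}}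

  -- A mean value inequality: the derivative of the term of degree j + 1 is the term of degree j. An
  -- induction on the degree, after multiplication by j + 1, replaces the calculus.
  expTerm-upper : ∀ t h j → 0ℚ ≤ t → 0ℚ ≤ h → expTerm (t + h) (suc j) ≤ expTerm t (suc j) + h * expTerm (t + h) j
  expTerm-upper t h j 0≤t 0≤h = cancel-suc j (begin
      expTerm s (suc j) * ℕtoℚ (suc j)                                           ≡⟨ expTerm-suc s j ⟩
      expTerm s j * s                                                            ≤⟨ scaled j ⟩
      expTerm t j * t + h * expTerm s j * ℕtoℚ (suc j)                           ≡⟨ cong (_+ h * expTerm s j * ℕtoℚ (suc j)) (expTerm-suc t j) ⟨
      expTerm t (suc j) * ℕtoℚ (suc j) + h * expTerm s j * ℕtoℚ (suc j)          ≡⟨ *-distribʳ-+ (ℕtoℚ (suc j)) (expTerm t (suc j)) (h * expTerm s j) ⟨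
      (expTerm t (suc j) + h * expTerm s j) * ℕtoℚ (suc j)                       ∎)
    where
    open ≤-Reasoning
    s = t + h
    0≤s = 0≤+ 0≤t 0≤h
    t≤s : t ≤ s
    t≤s = subst (_≤ s) (+-identityʳ t) (+-monoʳ-≤ t 0≤h)
    scaled : ∀ j → expTerm s j * s ≤ expTerm t j * t + h * expTerm s j * ℕtoℚ (suc j)
    scaled zero    = ≤-reflexive (solve 2 (λ t h → con 1ℚ :* (t :+ h) := con 1ℚ :* t :+ h :* con 1ℚ :* con 1ℚ) refl t h)
    scaled (suc j) = begin
      x * s                                                      ≡⟨ solve 3 (λ x t h → x :* (t :+ h) := t :* x :+ h :* x) refl x t h ⟩
      t * x + h * x                                              ≤⟨ +-monoˡ-≤ (h * x) (*-monoʳ 0≤t (expTerm-upper t h j 0≤t 0≤h)) ⟩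
      t * (y + h * z) + h * x                                    ≡⟨ solve 5 (λ x y z t h → t :* (y :+ h :* z) :+ h :* x := y :* t :+ h :* (z :* t) :+ h :* x) refl x y z t h ⟩
      y * t + h * (z * t) + h * x                                ≤⟨ +-monoˡ-≤ (h * x) (+-monoʳ-≤ (y * t) (*-monoʳ 0≤h (*-monoʳ (0≤expTerm j 0≤s) t≤s))) ⟩
      y * t + h * (z * s) + h * x                                ≡⟨ cong (λ v → y * t + h * v + h * x) (expTerm-suc s j) ⟨
      y * t + h * (x * ℕtoℚ (suc j)) + h * x                     ≡⟨ solve 5 (λ x y t h v → y :* t :+ h :* (x :* v) :+ h :* x := y :* t :+ h :* x :* (con 1ℚ :+ v)) refl x y t h (ℕtoℚ (suc j)) ⟩
      y * t + h * x * (1ℚ + ℕtoℚ (suc j))                        ≡⟨ cong (λ v → y * t + h * x * v) (ℕtoℚ-suc (suc j)) ⟨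
      y * t + h * x * ℕtoℚ (suc (suc j))                         ∎
      where
      x = expTerm s (suc j)
      y = expTerm t (suc j)
      z = expTerm s j

  -- The left side consists of the first two terms in the binomial expansion of (t + 1) ^ (j + 1) /
  -- (j + 1)!.
  expTerm-lower : ∀ t j → 0ℚ ≤ t → expTerm t (suc j) + expTerm t j ≤ expTerm (t + 1ℚ) (suc j)
  expTerm-lower t j 0≤t = cancel-suc j (begin
      (expTerm t (suc j) + expTerm t j) * ℕtoℚ (suc j)                           ≡⟨ *-distribʳ-+ (ℕtoℚ (suc j)) (expTerm t (suc j)) (expTerm t j) ⟩
      expTerm t (suc j) * ℕtoℚ (suc j) + expTerm t j * ℕtoℚ (suc j)              ≡⟨ cong (_+ expTerm t j * ℕtoℚ (suc j)) (expTerm-suc t j) ⟩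
      expTerm t j * t + expTerm t j * ℕtoℚ (suc j)                               ≤⟨ scaled j ⟩
      expTerm s j * s                                                            ≡⟨ expTerm-suc s j ⟨
      expTerm s (suc j) * ℕtoℚ (suc j)                                           ∎)
    where
    open ≤-Reasoning
    s = t + 1ℚ
    0≤s = 0≤+ 0≤t 0≤1
    scaled : ∀ j → expTerm t j * t + expTerm t j * ℕtoℚ (suc j) ≤ expTerm s j * s
    scaled zero    = ≤-reflexive (solve 1 (λ t → con 1ℚ :* t :+ con 1ℚ :* con 1ℚ := con 1ℚ :* (t :+ con 1ℚ)) refl t)
    scaled (suc j) = begin
      y * t + y * ℕtoℚ (suc (suc j))                ≡⟨ cong (λ v → y * t + y * v) (ℕtoℚ-suc (suc j)) ⟩
      y * t + y * (1ℚ + ℕtoℚ (suc j))               ≡⟨ solve 3 (λ y t v → y :* t :+ y :* (con 1ℚ :+ v) := y :* t :+ y :+ y :* v) refl y t (ℕtoℚ (suc j)) ⟩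
      y * t + y + y * ℕtoℚ (suc j)                  ≡⟨ cong (λ v → y * t + y + v) (expTerm-suc t j) ⟩
      y * t + y + z * t                             ≡⟨ +-identityʳ (y * t + y + z * t) ⟨
      y * t + y + z * t + 0ℚ                        ≤⟨ +-monoʳ-≤ (y * t + y + z * t) (0≤expTerm j 0≤t) ⟩
      y * t + y + z * t + z                         ≡⟨ solve 3 (λ y z t → y :* t :+ y :+ z :* t :+ z := (y :+ z) :* (t :+ con 1ℚ)) refl y z t ⟩
      (y + z) * s                                   ≤⟨ *-monoʳ-≤-nonNeg s {{nonNegative 0≤s}} (expTerm-lower t j 0≤t) ⟩
      expTerm s (suc j) * s                         ∎
      where
      y = expTerm t (suc j)
      z = expTerm t j

  expPartial-upper : ∀ t h N → 0ℚ ≤ t → 0ℚ ≤ h → expPartial (t + h) (suc N) ≤ expPartial t (suc N) + h * expPartial (t + h) N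
  expPartial-upper t h zero    0≤t 0≤h = ≤-reflexive (solve 1 (λ h → con 0ℚ :+ con 1ℚ := con 0ℚ :+ con 1ℚ :+ h :* con 0ℚ) refl h)
  expPartial-upper t h (suc N) 0≤t 0≤h = ≤-trans (+-mono-≤ (expPartial-upper t h N 0≤t 0≤h) (expTerm-upper t h N 0≤t 0≤h))
    (≤-reflexive (solve 5 (λ a b c d h → a :+ h :* b :+ (c :+ h :* d) := a :+ c :+ h :* (b :+ d)) refl
      (expPartial t (suc N)) (expPartial (t + h) N) (expTerm t (suc N)) (expTerm (t + h) N) h))

  expPartial-lower : ∀ t N → 0ℚ ≤ t → expPartial t (suc N) + expPartial t N ≤ expPartial (t + 1ℚ) (suc N)
  expPartial-lower t zero    0≤t = ≤-refl
  expPartial-lower t (suc N) 0≤t = ≤-trans (≤-reflexive (solve 4 (λ a b c d → a :+ c :+ (b :+ d) := a :+ b :+ (c :+ d)) refl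
      (expPartial t (suc N)) (expPartial t N) (expTerm t (suc N)) (expTerm t N)))
    (+-mono-≤ (expPartial-lower t N 0≤t) (expTerm-lower t N 0≤t))

  -- `expPartial-upper` bounds the value at t + ½ by the value at t plus half of itself. Two such
  -- doublings make up the factor 4 per unit, hence the base 4.
  expPartial-half : ∀ t N → 0ℚ ≤ t → expPartial (t + ½) N ≤ expPartial t N + expPartial t N
  expPartial-half t zero    0≤t = ≤-refl
  expPartial-half t (suc N) 0≤t = ≤-trans (≤-reflexive (solve 1 (λ x → x := (x :+ :- (con ½ :* x)) :+ (x :+ :- (con ½ :* x))) refl x)) (+-mono-≤ x/2≤y x/2≤y)
    where
    open ≤-Reasoning
    x = expPartial (t + ½) (suc N)
    y = expPartial t (suc N)
    0≤½ : 0ℚ ≤ ½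
    0≤½ = nonNegative⁻¹ ½
    x/2≤y : x - ½ * x ≤ y
    x/2≤y = begin
      x - ½ * x                  ≤⟨ +-monoˡ-≤ (- (½ * x)) (≤-trans (expPartial-upper t ½ N 0≤t 0≤½) (+-monoʳ-≤ y (*-monoʳ 0≤½ (expPartial-suc N (0≤+ 0≤t 0≤½))))) ⟩
      y + ½ * x - ½ * x          ≡⟨ solve 2 (λ x y → y :+ con ½ :* x :+ :- (con ½ :* x) := y) refl x y ⟩
      y                          ∎

  expPartial-0 : ∀ N → expPartial 0ℚ N ≤ 1ℚ
  expPartial-0 zero    = 0≤1
  expPartial-0 (suc N) = ≤-reflexive (one N)
    where
    expTerm-0 : ∀ j → expTerm 0ℚ (suc j) ≡ 0ℚ
    expTerm-0 j = trans (cong (_* recip j) (*-zeroʳ (expTerm 0ℚ j))) (*-zeroˡ (recip j))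
    one : ∀ N → expPartial 0ℚ (suc N) ≡ 1ℚ
    one zero    = refl
    one (suc N) = trans (cong₂ _+_ (one N) (expTerm-0 N)) (+-identityʳ 1ℚ)

  expPartial≤4^ : ∀ L N → expPartial (ℕtoℚ L) N ≤ ℕtoℚ (4 ℕ.^ L)
  expPartial≤4^ zero    N = expPartial-0 N
  expPartial≤4^ (suc L) N = begin
      expPartial (ℕtoℚ (suc L)) N                  ≡⟨ cong (λ s → expPartial s N) (trans (ℕtoℚ-suc L) (solve 1 (λ t → con 1ℚ :+ t := t :+ con ½ :+ con ½) refl t)) ⟩
      expPartial (t + ½ + ½) N                     ≤⟨ expPartial-half (t + ½) N (0≤+ (0≤ℕtoℚ L) (nonNegative⁻¹ ½)) ⟩
      expPartial (t + ½) N + expPartial (t + ½) N  ≤⟨ +-mono-≤ twice twice ⟩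
      v + v + (v + v)                              ≡⟨ solve 1 (λ v → v :+ v :+ (v :+ v) := con (ℕtoℚ 4) :* v) refl v ⟩
      ℕtoℚ 4 * v                                   ≡⟨ ℕtoℚ-* 4 (4 ℕ.^ L) ⟨
      ℕtoℚ (4 ℕ.^ suc L)                           ∎
    where
    open ≤-Reasoning
    t = ℕtoℚ L
    v = ℕtoℚ (4 ℕ.^ L)
    twice : expPartial (t + ½) N ≤ v + v
    twice = ≤-trans (expPartial-half t N (0≤ℕtoℚ L)) (+-mono-≤ (expPartial≤4^ L N) (expPartial≤4^ L N))

  -- A unit step at least doubles the sum but needs one more term, so the number of terms grows with
  -- M.
  2^≤expPartial : ∀ M → ℕtoℚ (2 ℕ.^ M) ≤ expPartial (ℕtoℚ M) (suc M)
  2^≤expPartial zero    = ≤-refl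
  2^≤expPartial (suc M) = begin
      ℕtoℚ (2 ℕ.^ suc M)                                                     ≡⟨ ℕtoℚ-* 2 (2 ℕ.^ M) ⟩
      ℕtoℚ 2 * v                                                             ≡⟨ solve 1 (λ v → con (ℕtoℚ 2) :* v := v :+ v) refl v ⟩
      v + v                                                                  ≤⟨ +-mono-≤ (≤-trans (2^≤expPartial M) (expPartial-suc (suc M) (0≤ℕtoℚ M))) (2^≤expPartial M) ⟩
      expPartial (ℕtoℚ M) (suc (suc M)) + expPartial (ℕtoℚ M) (suc M)        ≤⟨ expPartial-lower (ℕtoℚ M) (suc M) (0≤ℕtoℚ M) ⟩
      expPartial (ℕtoℚ M + 1ℚ) (suc (suc M))                                 ≡⟨ cong (λ s → expPartial s (suc (suc M))) (trans (+-comm (ℕtoℚ M) 1ℚ) (sym (ℕtoℚ-suc M))) ⟩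
      expPartial (ℕtoℚ (suc M)) (suc (suc M))                                ∎
    where
    open ≤-Reasoning
    v = ℕtoℚ (2 ℕ.^ M)

  module _ (n L : ℕ) (4^L≤n : 4 ℕ.^ L ℕ.≤ n) (n<4^L : n ℕ.< 4 ℕ.^ suc L) where

    -- Uses log n < 2(L + 1): a t with p < u · tᵏ is at least 2(L + 1), where the series already
    -- exceeds n.
    mulLogPowLe : ∀ k u p → u ℕ.* (2 ℕ.* suc L) ℕ.^ k ℕ.≤ p → MulLogPowLe k n (ℕtoℚ u) (ℕtoℚ p)
    mulLogPowLe k u p uM≤p t 0≤t p<ut = suc M , <-≤-trans (<-≤-trans (ℕtoℚ-mono-< n<2^M) (2^≤expPartial M)) (expPartial-mono (suc M) (0≤ℕtoℚ M) M≤t)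
      where
      M = 2 ℕ.* suc L
      n<2^M : n ℕ.< 2 ℕ.^ M
      n<2^M = subst (n ℕ.<_) (ℕₚ.^-*-assoc 2 2 (suc L)) n<4^L
      M≤t : ℕtoℚ M ≤ t
      M≤t with ≤-total (ℕtoℚ M) t
      ... | inj₁ p = p
      ... | inj₂ t≤M with powℚ-mono k 0≤t t≤M
      ...   | _ , tᵏ≤ = ⊥-elim (<⇒≱ p<ut (≤-trans (*-monoʳ (0≤ℕtoℚ u) tᵏ≤)
          (≤-trans (≤-reflexive (trans (cong (ℕtoℚ u *_) (ℕtoℚ-^ M k)) (sym (ℕtoℚ-* u (M ℕ.^ k))))) (ℕtoℚ-mono-≤ uM≤p))))

    -- Uses L ≤ log n: at the test point t = L no partial sum exceeds 4 ^ L ≤ n.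
    mulLogPowLe⁻ : ∀ k u p → MulLogPowLe k n (ℕtoℚ u) (ℕtoℚ p) → u ℕ.* L ℕ.^ k ℕ.≤ p
    mulLogPowLe⁻ k u p h = ℕₚ.≮⇒≥ λ p<uL →
      let N , n< = h (ℕtoℚ L) (0≤ℕtoℚ L) (subst (ℕtoℚ p <_) (trans (ℕtoℚ-* u (L ℕ.^ k)) (cong (ℕtoℚ u *_) (sym (ℕtoℚ-^ L k)))) (ℕtoℚ-mono-< p<uL))
      in <⇒≱ n< (≤-trans (expPartial≤4^ L N) (ℕtoℚ-mono-≤ 4^L≤n))

    leMulLogPow : ∀ k u p → 0 ℕ.< p → p ℕ.≤ u ℕ.* L ℕ.^ k → LeMulLogPow k n (ℕtoℚ u) (ℕtoℚ p)
    leMulLogPow k zero    p 0<p p≤ = ⊥-elim (ℕₚ.<⇒≱ 0<p p≤)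
    leMulLogPow k (suc u) p 0<p p≤ = inj₂ (ℕtoℚ-mono-< {0} {suc u} ℕ.z<s , bound)
      where
      bound : ∀ t → 0ℚ ≤ t → ℕtoℚ (suc u) * powℚ t k < ℕtoℚ p → ∀ N → expPartial t N ≤ ℕtoℚ n
      bound t 0≤t ut<p N with ≤-total t (ℕtoℚ L)
      ... | inj₁ t≤L = ≤-trans (expPartial-mono N 0≤t t≤L) (≤-trans (expPartial≤4^ L N) (ℕtoℚ-mono-≤ 4^L≤n))
      ... | inj₂ L≤t with powℚ-mono k (0≤ℕtoℚ L) L≤t
      ...   | _ , Lᵏ≤ = ⊥-elim (<⇒≱ ut<p (≤-trans (ℕtoℚ-mono-≤ p≤)
          (≤-trans (≤-reflexive (trans (ℕtoℚ-* (suc u) (L ℕ.^ k)) (cong (ℕtoℚ (suc u) *_) (sym (ℕtoℚ-^ L k))))) (*-monoʳ (0≤ℕtoℚ (suc u)) Lᵏ≤))))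

  -- The denominator of ε serves as q, since ε ≥ 1/q; the fraction (1 + ε)/2 is weakened to (q +
  -- 1)/(2q).
  half-expansion : ∀ ε → 0ℚ < ε → ∃ λ q → 0 ℕ.< q × (∀ n N → ½ * (1ℚ + ε) * ℕtoℚ n ≤ ℕtoℚ N → suc q ℕ.* n ℕ.≤ 2 ℕ.* q ℕ.* N)
  half-expansion (mkℚ (+ zero) d c)       0<ε = ⊥-elim (<⇒≱ 0<ε (nonPositive⁻¹ (mkℚ (+ zero) d c)))
  half-expansion (mkℚ ℤ.-[1+ p ] d c)     0<ε = ⊥-elim (<⇒≱ 0<ε (nonPositive⁻¹ (mkℚ ℤ.-[1+ p ] d c)))
  half-expansion ε@(mkℚ (+ suc p) d c)    0<ε = suc d , ℕ.z<s , λ n N h → ℕtoℚ-cancel-≤ (begin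
      ℕtoℚ (suc (suc d) ℕ.* n)                       ≡⟨ ℕtoℚ-* (suc (suc d)) n ⟩
      ℕtoℚ (suc (suc d)) * ℕtoℚ n                    ≡⟨ cong (_* ℕtoℚ n) (ℕtoℚ-suc (suc d)) ⟩
      (1ℚ + q) * ℕtoℚ n                              ≤⟨ *-monoʳ-≤-nonNeg (ℕtoℚ n) {{nonNegative (0≤ℕtoℚ n)}} (+-monoˡ-≤ q 1≤εq) ⟩
      (ε * q + q) * ℕtoℚ n                           ≡⟨ solve 3 (λ e q n → (e :* q :+ q) :* n := con (ℕtoℚ 2) :* q :* (con ½ :* (con 1ℚ :+ e) :* n)) refl ε q (ℕtoℚ n) ⟩
      ℕtoℚ 2 * q * (½ * (1ℚ + ε) * ℕtoℚ n)           ≤⟨ *-monoʳ (0≤* (0≤ℕtoℚ 2) (0≤ℕtoℚ (suc d))) h ⟩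
      ℕtoℚ 2 * q * ℕtoℚ N                            ≡⟨ cong (_* ℕtoℚ N) (ℕtoℚ-* 2 (suc d)) ⟨
      ℕtoℚ (2 ℕ.* suc d) * ℕtoℚ N                    ≡⟨ ℕtoℚ-* (2 ℕ.* suc d) N ⟨
      ℕtoℚ (2 ℕ.* suc d ℕ.* N)                       ∎)
    where
    open ≤-Reasoning
    q = ℕtoℚ (suc d)
    recip≤ε : recip d ≤ ε
    recip≤ε = subst (_≤ ε) (sym (recip≡mkℚ d)) (*≤* (ℤₚ.*-monoʳ-≤-nonNeg (+ suc d) {+ 1} {+ suc p} (ℤ.+≤+ (ℕ.s≤s ℕ.z≤n))))
    1≤εq : 1ℚ ≤ ε * q
    1≤εq = subst (_≤ ε * q) (recip-inverse d) (*-monoʳ-≤-nonNeg q {{nonNegative (0≤ℕtoℚ (suc d))}} recip≤ε)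

-- From a longest path of the graph to a Hamilton cycle.

module GraphCycles where

  open Prelude
  open Counting
  open SymbolicPaths
  open SymbolicRotations
  open PivotSelection
  open RotationSteps
  open EndpointGrowth
  open ClosingUp
  open ParameterChoice
  import Data.Bool as Bool
  open import Data.Bool using (_∧_)
  open import Data.Bool.Properties using (T-≡; T-∧)
  import Data.Fin as Fin
  import Data.Fin.Properties as Finₚ
  open import Data.Fin using (Fin; toℕ)
  open import Data.Fin.Subset using (Subset; ∣_∣)
  open import Data.Vec using ([]; _∷_; lookup; tabulate)
  open import Data.Vec.Properties using (lookup∘tabulate)
  open import Data.List.Membership.Propositional using (find; lose)
  open import Data.List.Relation.Unary.Any as Any using (Any; any?)
  open import Data.List.Relation.Unary.Any.Properties using (any⁻)
  open import Data.List.Relation.Unary.All as All using ()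
  open import Data.List.Relation.Unary.Linked using (Linked; []; [-]; _∷_; linked?)
  open import Data.List.Relation.Unary.Unique.Propositional.Properties as Uniqueₚ using ()
  open import Function.Bundles using (Equivalence)
  open import Relation.Nullary using (does)
  open import Relation.Nullary.Decidable using (map′; dec-true)
  open import Defs using (Graph; adj; nbhd; Reach; here; step; Connected; next; HasHamiltonCycle) renaming (sym to adj-sym)

  elements : ∀ {n} → Subset n → List (Fin n)
  elements []          = []
  elements (true ∷ s)  = Fin.zero ∷ map Fin.suc (elements s)
  elements (false ∷ s) = map Fin.suc (elements s)

  length-elements : ∀ {n} (s : Subset n) → length (elements s) ≡ ∣ s ∣
  length-elements []          = refl
  length-elements (true ∷ s)  = cong suc (trans (length-map Fin.suc (elements s)) (length-elements s))
  length-elements (false ∷ s) = trans (length-map Fin.suc (elements s)) (length-elements s)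

  elements! : ∀ {n} (s : Subset n) → Unique (elements s)
  elements! []          = []
  elements! (true ∷ s)  = All.tabulate (λ v∈ 0≡v → let _ , _ , v≡ = ∈-map⁻ Fin.suc v∈ in Finₚ.0≢1+n (trans 0≡v v≡)) ∷ Uniqueₚ.map⁺ Finₚ.suc-injective (elements! s)
  elements! (false ∷ s) = Uniqueₚ.map⁺ Finₚ.suc-injective (elements! s)

  ∈-elements⁻ : ∀ {n} (s : Subset n) {v} → v ∈ elements s → lookup s v ≡ true
  ∈-elements⁻ (true ∷ s)  (here refl) = refl
  ∈-elements⁻ (true ∷ s)  (there v∈) with ∈-map⁻ Fin.suc v∈
  ... | _ , u∈ , refl = ∈-elements⁻ s u∈
  ∈-elements⁻ (false ∷ s) v∈ with ∈-map⁻ Fin.suc v∈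
  ... | _ , u∈ , refl = ∈-elements⁻ s u∈

  ∈-elements⁺ : ∀ {n} (s : Subset n) {v} → lookup s v ≡ true → v ∈ elements s
  ∈-elements⁺ (true ∷ s)  {Fin.zero}  _  = here refl
  ∈-elements⁺ (true ∷ s)  {Fin.suc v} eq = there (∈-map⁺ Fin.suc (∈-elements⁺ s eq))
  ∈-elements⁺ (false ∷ s) {Fin.suc v} eq = ∈-map⁺ Fin.suc (∈-elements⁺ s eq)

  module _ {n : ℕ} where

    open import Data.List.Membership.DecPropositional (Fin._≟_ {n}) using (_∈?_; _∉?_)

    fromList : List (Fin n) → Subset n
    fromList us = tabulate (λ v → does (v ∈? us))

    lookup-fromList⁺ : ∀ {us v} → v ∈ us → lookup (fromList us) v ≡ true
    lookup-fromList⁺ {us} {v} v∈ = trans (lookup∘tabulate (λ v → does (v ∈? us)) v) (dec-true (v ∈? us) v∈)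

    lookup-fromList⁻ : ∀ {us v} → lookup (fromList us) v ≡ true → v ∈ us
    lookup-fromList⁻ {us} {v} eq with v ∈? us | trans (sym (lookup∘tabulate (λ v → does (v ∈? us)) v)) eq
    ... | yes v∈ | _  = v∈
    ... | no _   | ()

    ∣fromList∣ : ∀ {us} → Unique us → ∣ fromList us ∣ ≡ length us
    ∣fromList∣ {us} us! = trans (sym (length-elements (fromList us))) (≤-antisym
      (Unique-⊆⇒length≤ {ys = us} (elements! (fromList us)) (λ v∈ → lookup-fromList⁻ {us} (∈-elements⁻ (fromList us) v∈)))
      (Unique-⊆⇒length≤ us! (λ v∈ → ∈-elements⁺ (fromList us) (lookup-fromList⁺ v∈))))

    length≤n : ∀ {us : List (Fin n)} → Unique us → length us ≤ n
    length≤n us! = ≤-trans (Unique-⊆⇒length≤ us! (λ {v} _ → ∈-allFin v)) (≤-reflexive (length-tabulate id))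

    missing-vertex : ∀ vs → length vs < n → ∃ λ z → z ∉ vs
    missing-vertex vs len< with any? (_∉? vs) (allFin n)
    ... | yes out = let z , _ , z∉ = find out in z , z∉
    ... | no ¬out = ⊥-elim (<⇒≱ len< (≤-trans (≤-reflexive (sym (length-tabulate id))) (Unique-⊆⇒length≤ (Uniqueₚ.allFin⁺ n) present)))
      where
      present : ∀ {v} → v ∈ allFin n → v ∈ vs
      present {v} v∈ with v ∈? vs
      ... | yes p = p
      ... | no ¬p = ⊥-elim (¬out (lose v∈ ¬p))

  -- Total, with a default value, so that positions can remain plain numbers in the symbolic part.
  nth : {A : Set} → A → List A → ℕ → A
  nth d []       _       = d
  nth d (x ∷ xs) zero    = x
  nth d (x ∷ xs) (suc i) = nth d xs i

  nth-∈ : {A : Set} (d : A) (xs : List A) {i : ℕ} → i < length xs → nth d xs i ∈ xs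
  nth-∈ d (x ∷ xs) {zero}  _        = here refl
  nth-∈ d (x ∷ xs) {suc i} (s≤s i<) = there (nth-∈ d xs i<)

  ∈-nth : {A : Set} (d : A) (xs : List A) {x : A} → x ∈ xs → ∃ λ i → i < length xs × nth d xs i ≡ x
  ∈-nth d (x ∷ xs) (here refl) = 0 , z<s , refl
  ∈-nth d (x ∷ xs) (there x∈)  = let i , i< , eq = ∈-nth d xs x∈ in suc i , s≤s i< , eq

  nth-injective : {A : Set} (d : A) {xs : List A} → Unique xs → ∀ {i j} → i < length xs → j < length xs → nth d xs i ≡ nth d xs j → i ≡ j
  nth-injective d (x∉ ∷ xs!) {zero}  {zero}  _ _ _ = refl
  nth-injective d {_ ∷ xs} (x∉ ∷ xs!) {zero}  {suc j} _ (s≤s j<) eq = ⊥-elim (All.lookup x∉ (nth-∈ d xs j<) eq)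
  nth-injective d {_ ∷ xs} (x∉ ∷ xs!) {suc i} {zero}  (s≤s i<) _ eq = ⊥-elim (All.lookup x∉ (nth-∈ d xs i<) (sym eq))
  nth-injective d (x∉ ∷ xs!) {suc i} {suc j} (s≤s i<) (s≤s j<) eq = cong suc (nth-injective d xs! i< j< eq)

  nth-linked : {A : Set} {R : A → A → Set} (d : A) {xs : List A} → Linked R xs → ∀ i → suc i < length xs → R (nth d xs i) (nth d xs (suc i))
  nth-linked d (r ∷ l) zero    _        = r
  nth-linked d [-]     zero    (s≤s ())
  nth-linked d (r ∷ l) (suc i) (s≤s i<) = nth-linked d l i i<

  Unique-map-on : {A B : Set} (f : A → B) {xs : List A} → (∀ {x y} → x ∈ xs → y ∈ xs → f x ≡ f y → x ≡ y) → Unique xs → Unique (map f xs)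
  Unique-map-on f inj []         = []
  Unique-map-on f {x ∷ xs} inj (x∉ ∷ xs!) =
    All.tabulate (λ fy∈ eq → let y , y∈ , fy≡ = ∈-map⁻ f fy∈ in All.lookup x∉ y∈ (inj (here refl) (there y∈) (trans eq fy≡)))
    ∷ Unique-map-on f (λ x∈ y∈ → inj (there x∈) (there y∈)) xs!

  -- Exhaustive search through the finitely many lists of a given length; it makes the choice of a
  -- longest path constructive.
  ∃-length? : ∀ {n} {P : List (Fin n) → Set} → (∀ xs → Dec (P xs)) → ∀ k → Dec (∃ λ xs → length xs ≡ k × P xs)
  ∃-length? P? zero = map′ (λ p → [] , refl , p) (λ { ([] , _ , p) → p }) (P? [])
  ∃-length? P? (suc k) = map′ (λ { (v , xs , len , p) → v ∷ xs , cong suc len , p })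
    (λ { (v ∷ xs , len , p) → v , xs , suc-injective len , p })
    (Finₚ.any? λ v → ∃-length? (λ xs → P? (v ∷ xs)) k)

  largest : ∀ {P : ℕ → Set} → (∀ k → Dec (P k)) → ∀ N → (∀ {j} → N < j → ¬ P j) → P 1 →
    ∃ λ m → 0 < m × P m × (∀ {j} → m < j → ¬ P j)
  largest P? zero    none p₁ = ⊥-elim (none z<s p₁)
  largest P? (suc N) none p₁ with P? (suc N)
  ... | yes p = suc N , z<s , p , none
  ... | no ¬p = largest P? N none′ p₁
    where
    none′ : ∀ {j} → N < j → ¬ _
    none′ {j} N<j pj with suc N ≟ j
    ... | yes refl = ¬p pj
    ... | no ≢     = none (≤∧≢⇒< N<j ≢) pj

  module Paths {n : ℕ} (G : Graph n) where

    open import Data.List.Membership.DecPropositional (Fin._≟_ {n}) using (_∈?_)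
    open import Data.List.Relation.Unary.Unique.DecPropositional (Fin._≟_ {n}) using (unique?)

    Adj : Fin n → Fin n → Set
    Adj u v = adj G u v ≡ true

    adj? : ∀ u v → Dec (Adj u v)
    adj? u v = adj G u v Bool.≟ true

    Adj-sym : ∀ {u v} → Adj u v → Adj v u
    Adj-sym {u} {v} e = trans (adj-sym G v u) e

    IsPath : List (Fin n) → Set
    IsPath vs = Unique vs × Linked Adj vs

    HasPath : ℕ → Set
    HasPath k = ∃ λ vs → length vs ≡ k × IsPath vs

    longest : Fin n → ∃ λ m → 0 < m × HasPath m × (∀ {j} → m < j → ¬ HasPath j)
    longest v = largest (∃-length? (λ vs → unique? vs ×-dec linked? adj? vs)) n
      (λ n<j → λ { (vs , refl , vs! , _) → <⇒≱ n<j (length≤n vs!) }) (v ∷ [] , refl , [] ∷ [] , [-])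

    crossing : ∀ vs {u z} → Reach G u z → u ∈ vs → z ∉ vs → ∃ λ x → ∃ λ y → x ∈ vs × y ∉ vs × Adj x y
    crossing vs here u∈ z∉ = ⊥-elim (z∉ u∈)
    crossing vs (step {u} {w} e r) u∈ z∉ with w ∈? vs
    ... | yes w∈ = crossing vs r w∈ z∉
    ... | no w∉  = u , w , u∈ , w∉ , e

    ∈-nbhd⁻ : ∀ {us v} → lookup (nbhd G (fromList us)) v ≡ true → ∃ λ u → u ∈ us × Adj u v
    ∈-nbhd⁻ {us} {v} eq with find (any⁻ (λ u → lookup (fromList us) u ∧ adj G u v) (allFin n)
      (Equivalence.from T-≡ (trans (sym (lookup∘tabulate _ v)) eq)))
    ... | u , _ , both = let u∈ , e = Equivalence.to T-∧ both in
      u , lookup-fromList⁻ (Equivalence.to T-≡ u∈) , Equivalence.to T-≡ e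

    module OnPath (v₀ : Fin n) (vs : List (Fin n)) (0<m : 0 < length vs) (vs! : Unique vs) (vs-linked : Linked Adj vs)
      (no-longer : ∀ {j} → length vs < j → ¬ HasPath j) where

      m : ℕ
      m = length vs

      vertex : ℕ → Fin n
      vertex = nth v₀ vs

      E : ℕ → ℕ → Set
      E x y = Adj (vertex x) (vertex y)

      E? : ∀ x y → Dec (E x y)
      E? x y = adj? (vertex x) (vertex y)

      E-sym : ∀ {x y} → E x y → E y x
      E-sym = Adj-sym

      open Walks E
      open Rotations m E E-sym
      open Steps m E E? E-sym
      open Growth m E E? E-sym
      open Closing m E E? E-sym

      vertex-unique : ∀ {xs} → xs ↭ upTo m → Unique (map vertex xs)
      vertex-unique perm = Unique-map-on vertex
        (λ x∈ y∈ → nth-injective v₀ vs! (∈-upTo⁻ (∈-resp-↭ perm x∈)) (∈-upTo⁻ (∈-resp-↭ perm y∈)))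
        (Unique-↭ (↭-sym perm) (Uniqueₚ.upTo⁺ m))

      walk-linked : ∀ {a b xs z} → Walk a xs b → Adj z (vertex a) → Linked Adj (z ∷ map vertex xs)
      walk-linked nil        e = e ∷ [-]
      walk-linked (cons f w) e = e ∷ walk-linked w f

      -- Otherwise z, put in front of the walk, would give a path longer than the longest.
      no-extension : ∀ {a b xs z} → Spans a b xs → Adj z (vertex a) → z ∈ vs
      no-extension {xs = xs} {z} (w , perm) e with z ∈? vs
      ... | yes z∈ = z∈
      ... | no z∉ = ⊥-elim (no-longer ≤-refl (z ∷ map vertex xs , len , (new ∷ vertex-unique perm) , walk-linked w e))
        where
        len : length (z ∷ map vertex xs) ≡ suc m
        len = cong suc (trans (length-map vertex xs) (trans (↭-length perm) (length-upTo m)))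
        new : All (z ≢_) (map vertex xs)
        new = All.tabulate λ v∈ z≡v → let x , x∈ , v≡ = ∈-map⁻ vertex v∈ in
          z∉ (subst (_∈ vs) (sym (trans z≡v v≡)) (nth-∈ v₀ vs (∈-upTo⁻ (∈-resp-↭ perm x∈))))

      endpoint<m : ∀ {a} → EndPoint a → a < m
      endpoint<m (_ , _ ∷ _ , w , perm) with walk-head w
      ... | refl = ∈-upTo⁻ (∈-resp-↭ perm (here refl))

      vertices : List ℕ → Subset n
      vertices U = fromList (map vertex U)

      module _ {U : List ℕ} (U! : Unique U) (ends : ∀ {u} → u ∈ U → EndPoint u) where

        ∣vertices∣ : ∣ vertices U ∣ ≡ length U
        ∣vertices∣ = trans (∣fromList∣ (Unique-map-on vertex
          (λ x∈ y∈ → nth-injective v₀ vs! (endpoint<m (ends x∈)) (endpoint<m (ends y∈))) U!)) (length-map vertex U)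

        -- By `no-extension` the neighbourhood in G lies on the path, so expansion in G carries over
        -- to positions.
        ∣nbhd∣≤ : ∣ nbhd G (vertices U) ∣ ≤ length (nbrs U)
        ∣nbhd∣≤ = begin
            ∣ nbhd G (vertices U) ∣                 ≡⟨ length-elements (nbhd G (vertices U)) ⟨
            length (elements (nbhd G (vertices U))) ≤⟨ Unique-⊆⇒length≤ (elements! (nbhd G (vertices U))) inside ⟩
            length (map vertex (nbrs U))            ≡⟨ length-map vertex (nbrs U) ⟩
            length (nbrs U)                         ∎
          where
          open ≤-Reasoning
          inside : ∀ {v} → v ∈ elements (nbhd G (vertices U)) → v ∈ map vertex (nbrs U)
          inside {v} v∈ =
            let u , u∈ , e = ∈-nbhd⁻ (∈-elements⁻ (nbhd G (vertices U)) v∈)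
                a , a∈ , u≡ = ∈-map⁻ vertex u∈
                _ , _ , sp = ends a∈
                av = subst (λ u → Adj u v) u≡ e
                x , x<m , x≡ = ∈-nth v₀ vs (no-extension sp (Adj-sym av))
            in subst (_∈ map vertex (nbrs U)) x≡ (∈-map⁺ vertex
                 (∈-filter⁺ (adjacent? U) (∈-upTo⁺ x<m) (lose a∈ (subst (Adj (vertex a)) (sym x≡) av))))

      walk-cut : ∀ {a b} Q {p R} → Walk a (Q ++ p ∷ R) b → Q ≡ [] ⊎ ∃ λ y → Walk a Q y × Walk p (p ∷ R) b
      walk-cut []              w = inj₁ refl
      walk-cut (_ ∷ [])        (cons e w) with walk-head w
      ... | refl = inj₂ (_ , nil , w)
      walk-cut (_ ∷ Q@(_ ∷ _)) (cons e w) with walk-cut Q w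
      ... | inj₂ (y , w₁ , w₂) = inj₂ (y , cons e w₁ , w₂)

      -- A cycle can be opened at any of its vertices, which makes each of them the end of a
      -- spanning path.
      cycle-from : ∀ {a b xs p} → Spans a b xs → E b a → p ∈ xs → ∃ λ c → ∃ λ ys → Spans p c ys
      cycle-from (w , perm) e p∈ with ∈-∃++ p∈
      ... | Q , R , refl with walk-cut Q w
      ...   | inj₂ (y , w₁ , w₂) = y , _ , walk-++ w₂ e w₁ , ↭-trans (↭-++-comm (_ ∷ R) Q) perm
      ...   | inj₁ refl with walk-head w
      ...     | refl = _ , _ , w , perm

      walk-Linked : ∀ {a b xs} → Walk a xs b → Linked E xs
      walk-Linked nil                     = [-]
      walk-Linked (cons e nil)            = e ∷ [-]
      walk-Linked (cons e w@(cons _ _))   = e ∷ walk-Linked w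

      walk-end : ∀ {a b xs} → Walk a xs b → ∀ i → suc i ≡ length xs → nth 0 xs i ≡ b
      walk-end nil        zero    _  = refl
      walk-end (cons e w) (suc i) eq = walk-end w i (suc-injective eq)
      walk-end (cons e w@nil)        zero ()
      walk-end (cons e w@(cons _ _)) zero ()

      walk-start : ∀ {a b xs} → Walk a xs b → nth 0 xs 0 ≡ a
      walk-start nil        = refl
      walk-start (cons _ _) = refl

    toℕ-next : ∀ {n} (i : Fin (suc n)) → (suc (toℕ i) < suc n × toℕ (next i) ≡ suc (toℕ i)) ⊎ (suc (toℕ i) ≡ suc n × toℕ (next i) ≡ 0)
    toℕ-next {n} i with suc (toℕ i) <? suc n
    ... | yes lt = inj₁ (lt , trans (Finₚ.toℕ-fromℕ< (m%n<n (suc (toℕ i)) (suc n))) (m<n⇒m%n≡m lt))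
    ... | no ¬lt = inj₂ (eq , trans (Finₚ.toℕ-fromℕ< (m%n<n (suc (toℕ i)) (suc n))) (trans (cong (_% suc n) eq) (n%n≡0 (suc n))))
      where
      eq : suc (toℕ i) ≡ suc n
      eq = ≤-antisym (Finₚ.toℕ<n i) (≮⇒≥ ¬lt)

  module _ {n : ℕ} (G : Graph (suc n)) (connected : Connected G) where

    open Paths G

    hamilton : ∀ q L → 0 < q → Parameters q L (suc n) →
      (∀ U → ∣ U ∣ * (2 * suc L) ^ 4 ≤ suc n → ∣ U ∣ * L ^ 4 ≤ 15 * ∣ nbhd G U ∣) →
      (∀ W → suc n ≤ ∣ W ∣ * L ^ 3 → suc q * suc n ≤ 2 * q * ∣ nbhd G W ∣) → HasHamiltonCycle G
    hamilton q L 0<q P expand expand-half = from-longest (longest Fin.zero)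
      where
      from-longest : (∃ λ m → 0 < m × HasPath m × (∀ {j} → m < j → ¬ HasPath j)) → HasHamiltonCycle G
      from-longest (_ , 0<m , (vs , refl , vs! , linked) , no-longer) = from-cycle
          (cycle-from-expansion (suc n) k ℓ R T (L ^ 4) ((2 * suc L) ^ 4) g (L ^ 3) q 0<m m≤n (≤-trans m≤n n≤kℓ) 0<g 0<T D-large TM≤n T≤gᴿ gT-large few
            (λ i i< → nth-linked Fin.zero linked i i<)
            (λ U U! ends small → subst (λ z → z * L ^ 4 ≤ 15 * length (Steps.nbrs m E E? E-sym U)) (∣vertices∣ U! ends)
              (≤-trans (expand (vertices U) (subst (λ z → z * (2 * suc L) ^ 4 ≤ suc n) (sym (∣vertices∣ U! ends)) small)) (*-monoʳ-≤ 15 (∣nbhd∣≤ U! ends))))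
            (λ U U! ends big → ≤-trans (expand-half (vertices U) (subst (λ z → suc n ≤ z * L ^ 3) (sym (∣vertices∣ U! ends)) big))
              (*-monoʳ-≤ (2 * q) (∣nbhd∣≤ U! ends))))
        where
        open Parameters P
        open OnPath Fin.zero vs 0<m vs! linked no-longer
        open Walks E
        open Rotations m E E-sym using (Spans)
        open Closing m E E? E-sym
        m≤n : m ≤ suc n
        m≤n = length≤n vs!
        from-cycle : Cycle → HasHamiltonCycle G
        from-cycle (a , b , xs , sp@(w , perm) , ba) = (λ i → vertex (nth 0 xs (toℕ i))) , injective , adjacent
          where
          -- If a vertex were missing, connectivity would give an edge leaving the path at some x;
          -- the cycle opened at x could then be extended along it.
          m≡n : m ≡ suc n
          m≡n with m ≟ suc n
          ... | yes eq = eq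
          ... | no m≢n =
            let z , z∉ = missing-vertex vs (≤∧≢⇒< m≤n m≢n)
                x , y , x∈ , y∉ , e = crossing vs (connected (vertex 0) z) (nth-∈ Fin.zero vs 0<m) z∉
                p , p<m , p≡ = ∈-nth Fin.zero vs x∈
                _ , _ , sp′ = cycle-from sp ba (∈-resp-↭ (↭-sym perm) (∈-upTo⁺ p<m))
            in ⊥-elim (y∉ (no-extension sp′ (Adj-sym (subst (λ x → Adj x y) (sym p≡) e))))
          length-xs : length xs ≡ suc n
          length-xs = trans (trans (↭-length perm) (length-upTo m)) m≡n
          xs! : Unique xs
          xs! = Unique-↭ (↭-sym perm) (Uniqueₚ.upTo⁺ m)
          i<xs : ∀ (i : Fin (suc n)) → toℕ i < length xs
          i<xs i = subst (toℕ i <_) (sym length-xs) (Finₚ.toℕ<n i)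
          x<m : ∀ (i : Fin (suc n)) → nth 0 xs (toℕ i) < m
          x<m i = ∈-upTo⁻ (∈-resp-↭ perm (nth-∈ 0 xs (i<xs i)))
          injective : ∀ {i j} → vertex (nth 0 xs (toℕ i)) ≡ vertex (nth 0 xs (toℕ j)) → i ≡ j
          injective {i} {j} eq = Finₚ.toℕ-injective (nth-injective 0 xs! (i<xs i) (i<xs j) (nth-injective Fin.zero vs! (x<m i) (x<m j) eq))
          adjacent : ∀ i → adj G (vertex (nth 0 xs (toℕ i))) (vertex (nth 0 xs (toℕ (next i)))) ≡ true
          adjacent i with toℕ-next i
          ... | inj₁ (lt , eq) = subst (λ j → E (nth 0 xs (toℕ i)) (nth 0 xs j)) (sym eq)
                  (nth-linked 0 (walk-Linked w) (toℕ i) (subst (suc (toℕ i) <_) (sym length-xs) lt))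
          ... | inj₂ (last , eq) = subst₂ E (sym (walk-end w (toℕ i) (trans last (sym length-xs)))) (trans (sym (walk-start w)) (cong (nth 0 xs) (sym eq))) ba

-- Translation of the hypotheses into inequalities between integers.

open ParameterChoice using (module Choice; log₄; 4^-cancel-≤)
open LogarithmBounds
open GraphCycles using (hamilton)
import Data.Nat as ℕ
import Data.Nat.Properties as ℕₚ
open import Data.Product using (_,_)
open import Relation.Binary.PropositionalEquality using (subst) renaming (sym to ≡-sym)
open import Defs
open import Data.Nat using (ℕ; _≤_)
open import Data.Fin.Subset using (Subset; ∣_∣)
open import Data.Rational using (ℚ; _<_; _+_; _*_; 0ℚ; 1ℚ; ½)
open import Data.Product using (∃)

theorem4p6 : (ε : ℚ) → 0ℚ < ε →
    ∃ λ (n₀ : ℕ) → ∀ (n : ℕ) → n₀ ≤ n → (G : Graph n) → Connected G →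
    (∀ (U : Subset n) → MulLogPowLe 4 n (ℕtoℚ ∣ U ∣) (ℕtoℚ n) →
    MulLogPowLe 4 n (ℕtoℚ ∣ U ∣) (ℕtoℚ 15 * ℕtoℚ ∣ nbhd G U ∣)) →
    (∀ (W : Subset n) → LeMulLogPow 3 n (ℕtoℚ ∣ W ∣) (ℕtoℚ n) →
    (½ * (1ℚ + ε)) * ℕtoℚ n Data.Rational.≤ ℕtoℚ ∣ nbhd G W ∣) →
    HasHamiltonCycle G
theorem4p6 ε 0<ε =
  let q , 0<q , half = half-expansion ε 0<ε
      threshold = Choice.threshold q 0<q
  in 4 ℕ.^ threshold , λ
    { ℕ.zero    n₀≤0 → ⊥-elim (ℕₚ.<⇒≱ (ℕₚ.m^n>0 4 threshold) n₀≤0)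
    ; (ℕ.suc n) n₀≤n G connected expand expand-half →
        let N = ℕ.suc n
            L , lower , upper = log₄ N ℕ.z<s
        in hamilton G connected q L 0<q (Choice.parameters-exist q 0<q L N (4^-cancel-≤ n₀≤n upper) lower upper)
          -- The size condition is met with the upper bound 2(L + 1) for log n, the expansion is
          -- read off with the lower bound L.
          (λ U small → mulLogPowLe⁻ N L lower upper 4 ∣ U ∣ (15 ℕ.* ∣ nbhd G U ∣)
            (subst (MulLogPowLe 4 N (ℕtoℚ ∣ U ∣)) (≡-sym (ℕtoℚ-* 15 ∣ nbhd G U ∣))
              (expand U (mulLogPowLe N L lower upper 4 ∣ U ∣ N small))))
          (λ W large → half N ∣ nbhd G W ∣ (expand-half W (leMulLogPow N L lower upper 3 ∣ W ∣ N ℕ.z<s large)))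
    }
  where open import Data.Empty using (⊥-elim)
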